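{- Let $k\ge 1$ and $n\ge 3$ be integers with $n\geq 2k-1$. Then the adjacency spectrum of the graph $BL_n(k-1,k)$ consists of exactly the following eigenvalues with the following multiplicities: \begin{itemize} \item for each $j=0,1,\ldots,k-1$, each of the two numbers $+\sqrt{(k-j)(n-k+1-j)}$ and $-\sqrt{(k-j)(n-k+1-j)}$, with multiplicity $\binom{n}{j}-\binom{n}{j-1}$; \item $0$, with multiplicity $\binom{n}{k}-\binom{n}{k-1}$. \end{itemize}
   Context: Let $[n]=\{1,\ldots,n\}$. For $n\ge 3$, the Boolean lattice $BL_n$ is the graph whose vertices are all subsets of $[n]$, two subsets being adjacent if and only if their symmetric difference has exactly one element. $BL_n(k-1,k)$ is the induced subgraph of $BL_n$ on the set of all $(k-1)$-element subsets and all $k$-element subsets of $[n]$; that is, it is the bipartite graph in which a $(k-1)$-subset $U$ is adjacent to a $k$-subset $W$ if and only if $U\subset W$. The spectrum of a graph is the multiset of eigenvalues of its adjacency matrix. Conventions: $\binom{n}{ -1}=0$; an eigenvalue listed with multiplicity $0$ does not occur (this happens for the eigenvalue $0$ when $n=2k-1$). -}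

module Defs where

open import Algebra.Bundles using (CommutativeRing)
open import Data.Bool.Base using (if_then_else_)
open import Data.Fin.Base using (Fin)
open import Data.Fin.Subset using (Subset; inside; outside; ∣_∣; _∪_; _─_)
open import Data.Fin.Subset.Properties using (∪-comm)
open import Data.Integer.Base as ℤ using (+_; +≤+; +<+)
import Data.Integer.Properties as ℤ
open import Data.Irrelevant using ([_])
open import Data.List.Base using (List; []; _∷_; _++_; map; foldr; length; sum; upTo; concatMap)
open import Data.List.Membership.Propositional using (_∈_)
open import Data.List.Membership.Propositional.Properties using (∈-++⁺ˡ; ∈-++⁺ʳ; ∈-map⁺; ∈-map⁻)
open import Data.List.Relation.Unary.All using (All; []; _∷_)
open import Data.List.Relation.Unary.AllPairs using (AllPairs; []; _∷_)
open import Data.List.Relation.Unary.Any using (Any; here; there)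
open import Data.List.Relation.Unary.Unique.Propositional using (Unique)
import Data.List.Relation.Unary.Unique.Propositional.Properties as Unique
open import Data.Nat.Base as ℕ using (ℕ; zero; suc; _∸_; _⊔_)
open import Data.Nat.Combinatorics using (_C_)
import Data.Nat.Properties as ℕ
open import Data.Nat.Tactic.RingSolver using (solve-∀)
open import Data.Product.Base using (∃-syntax; _×_; _,_; proj₁; proj₂)
open import Data.Rational.Base as ℚ using (ℚ; 0ℚ; 1ℚ; ½)
import Data.Rational.Properties as ℚ
open import Data.Rational.Solver using (module +-*-Solver)
import Data.Rational.Unnormalised.Base as ℚᵘ
import Data.Rational.Unnormalised.Properties as ℚᵘ
open import Data.Refinement.Base using (Refinement-syntax; value; _,_)
open import Data.Sum.Base using (_⊎_; inj₁; inj₂)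
open import Data.Vec.Base using ([]; _∷_)
import Data.Vec.Properties as Vec
open import Function.Base using (_∘_; _on_)
open import Level using (0ℓ)
open import Relation.Binary.Core using (Rel)
open import Relation.Binary.Definitions using (Decidable)
open import Relation.Binary.PropositionalEquality
open import Relation.Nullary.Decidable using (⌊_⌋; _⊎-dec_)
open import Relation.Nullary.Decidable.Core using (yes; no)
open import Relation.Nullary.Negation.Core using (¬_; contradiction; contradiction-irr)
import Relation.Unary as Unary

------------------------------------------------------------------------
-- Rational estimates

private
  ½ε>0 : ∀ {ε} → 0ℚ ℚ.< ε → 0ℚ ℚ.< ½ ℚ.* ε
  ½ε>0 {ε} ε>0 = ℚ.positive⁻¹ _ {{ℚ.pos*pos⇒pos ½ ε {{ℚ.positive ε>0}}}}

  ½ε+½ε : ∀ ε → ½ ℚ.* ε ℚ.+ ½ ℚ.* ε ≡ ε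
  ½ε+½ε ε = trans (sym (ℚ.*-distribʳ-+ ε ½ ½)) (ℚ.*-identityˡ ε)

  sum-small : ∀ {ε} u v → ℚ.∣ u ∣ ℚ.< ½ ℚ.* ε → ℚ.∣ v ∣ ℚ.< ½ ℚ.* ε → ℚ.∣ u ℚ.+ v ∣ ℚ.< ε
  sum-small {ε} u v u< v< = ℚ.≤-<-trans (ℚ.∣p+q∣≤∣p∣+∣q∣ u v)
    (subst (_ ℚ.<_) (½ε+½ε ε) (ℚ.+-mono-< u< v<))

  product-small : ∀ {B ε} → 0ℚ ℚ.< B → 0ℚ ℚ.< ε → ∃[ δ ] 0ℚ ℚ.< δ ×
                  (∀ u v → ℚ.∣ u ∣ ℚ.< B → ℚ.∣ v ∣ ℚ.< δ → ℚ.∣ u ℚ.* v ∣ ℚ.< ε)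
  product-small {B} {ε} B>0 ε>0 = δ , ℚ.positive⁻¹ δ {{δ-pos}} , small
    where
    instance
      B-pos : ℚ.Positive B
      B-pos = ℚ.positive B>0
      B≢0 : ℚ.NonZero B
      B≢0 = ℚ.pos⇒nonZero B
      ε-pos : ℚ.Positive ε
      ε-pos = ℚ.positive ε>0
      1/B-pos : ℚ.Positive (ℚ.1/ B)
      1/B-pos = ℚ.1/pos⇒pos B
    δ : ℚ
    δ = ℚ.1/ B ℚ.* ε
    δ-pos : ℚ.Positive δ
    δ-pos = ℚ.pos*pos⇒pos (ℚ.1/ B) ε
    Bδ≡ε : B ℚ.* δ ≡ ε
    Bδ≡ε = trans (sym (ℚ.*-assoc B (ℚ.1/ B) ε))
             (trans (cong (ℚ._* ε) (ℚ.*-inverseʳ B)) (ℚ.*-identityˡ ε))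
    small : ∀ u v → ℚ.∣ u ∣ ℚ.< B → ℚ.∣ v ∣ ℚ.< δ → ℚ.∣ u ℚ.* v ∣ ℚ.< ε
    small u v u< v< = begin-strict
      ℚ.∣ u ℚ.* v ∣        ≡⟨ ℚ.∣p*q∣≡∣p∣*∣q∣ u v ⟩
      ℚ.∣ u ∣ ℚ.* ℚ.∣ v ∣  ≤⟨ ℚ.*-monoʳ-≤-nonNeg ℚ.∣ v ∣ {{ℚ.∣-∣-nonNeg v}} (ℚ.<⇒≤ u<) ⟩
      B ℚ.* ℚ.∣ v ∣        <⟨ ℚ.*-monoʳ-<-pos B v< ⟩
      B ℚ.* δ              ≡⟨ Bδ≡ε ⟩
      ε                    ∎
      where open ℚ.≤-Reasoning

  ∣p-q∣≡∣q-p∣ : ∀ p q → ℚ.∣ p ℚ.- q ∣ ≡ ℚ.∣ q ℚ.- p ∣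
  ∣p-q∣≡∣q-p∣ p q = trans (sym (ℚ.∣-p∣≡∣p∣ (p ℚ.- q)))
    (cong ℚ.∣_∣ (solve 2 (λ p q → :- (p :- q) := q :- p) refl p q))
    where open +-*-Solver

------------------------------------------------------------------------
-- Real numbers: Cauchy sequences of rationals modulo null sequences

Eventually : (ℕ → Set) → Set
Eventually P = ∃[ N ] ∀ n → N ℕ.≤ n → P n

Eventually-∩ : ∀ {P Q R : ℕ → Set} → (∀ n → P n → Q n → R n) →
               Eventually P → Eventually Q → Eventually R
Eventually-∩ f (M , p) (N , q) = M ⊔ N , λ n le →
  f n (p n (ℕ.≤-trans (ℕ.m≤m⊔n M N) le)) (q n (ℕ.≤-trans (ℕ.m≤n⊔m M N) le))

Cauchy : (ℕ → ℚ) → Set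
Cauchy x = ∀ ε → 0ℚ ℚ.< ε → ∃[ N ] ∀ m n → N ℕ.≤ m → N ℕ.≤ n → ℚ.∣ x m ℚ.- x n ∣ ℚ.< ε

record ℝ : Set where
  no-eta-equality
  field
    seq    : ℕ → ℚ
    cauchy : Cauchy seq

open ℝ public

infix  4 _≃_ _#_ _≤ʳ_
infix  8 -ʳ_
infixl 7 _*ʳ_
infixl 6 _+ʳ_

record _≃_ (x y : ℝ) : Set where
  constructor mk≃
  field
    close : ∀ ε → 0ℚ ℚ.< ε → Eventually λ n → ℚ.∣ seq x n ℚ.- seq y n ∣ ℚ.< ε

open _≃_ public

-- Apartness, the positive form of x ≠ y; classically it is ¬ (x ≃ y).
record _#_ (x y : ℝ) : Set where
  constructor mk#
  field
    gap   : ℚ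
    gap>0 : 0ℚ ℚ.< gap
    apart : Eventually λ n → gap ℚ.≤ ℚ.∣ seq x n ℚ.- seq y n ∣

record _≤ʳ_ (x y : ℝ) : Set where
  constructor mk≤
  field
    below : ∀ ε → 0ℚ ℚ.< ε → Eventually λ n → seq x n ℚ.< seq y n ℚ.+ ε

fromℚ : ℚ → ℝ
seq    (fromℚ q) _ = q
cauchy (fromℚ q) ε ε>0 = 0 , λ _ _ _ _ →
  subst (ℚ._< ε) (sym (cong ℚ.∣_∣ (ℚ.+-inverseʳ q))) ε>0

fromℕ : ℕ → ℝ
fromℕ a = fromℚ (+ a ℚ./ 1)

0ℝ 1ℝ : ℝ
0ℝ = fromℚ 0ℚ
1ℝ = fromℚ 1ℚ

bounded : ∀ x → ∃[ B ] 0ℚ ℚ.< B × Eventually λ n → ℚ.∣ seq x n ∣ ℚ.< B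
bounded x with cauchy x 1ℚ (ℚ.positive⁻¹ 1ℚ)
... | N , close = B , B>0 , N , below
  where
  c B : ℚ
  c = ℚ.∣ seq x N ∣
  B = 1ℚ ℚ.+ c
  B>0 : 0ℚ ℚ.< B
  B>0 = ℚ.+-mono-<-≤ (ℚ.positive⁻¹ 1ℚ) (ℚ.0≤∣p∣ (seq x N))
  below : ∀ n → N ℕ.≤ n → ℚ.∣ seq x n ∣ ℚ.< B
  below n N≤n = begin-strict
    ℚ.∣ seq x n ∣                               ≡⟨ cong ℚ.∣_∣ (solve 2 (λ p q → p := p :- q :+ q) refl (seq x n) (seq x N)) ⟩
    ℚ.∣ seq x n ℚ.- seq x N ℚ.+ seq x N ∣       ≤⟨ ℚ.∣p+q∣≤∣p∣+∣q∣ (seq x n ℚ.- seq x N) (seq x N) ⟩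
    ℚ.∣ seq x n ℚ.- seq x N ∣ ℚ.+ c             <⟨ ℚ.+-monoˡ-< c (close n N N≤n ℕ.≤-refl) ⟩
    B                                           ∎
    where
    open ℚ.≤-Reasoning
    open +-*-Solver

private
  +-diff : ∀ a b c d → (a ℚ.+ b) ℚ.- (c ℚ.+ d) ≡ (a ℚ.- c) ℚ.+ (b ℚ.- d)
  +-diff = solve 4 (λ a b c d → (a :+ b) :- (c :+ d) := (a :- c) :+ (b :- d)) refl
    where open +-*-Solver

  *-diff : ∀ a b c d → (a ℚ.* b) ℚ.- (c ℚ.* d) ≡ a ℚ.* (b ℚ.- d) ℚ.+ d ℚ.* (a ℚ.- c)
  *-diff = solve 4 (λ a b c d → (a :* b) :- (c :* d) := a :* (b :- d) :+ d :* (a :- c)) refl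
    where open +-*-Solver

  neg-diff : ∀ a b → (ℚ.- a) ℚ.- (ℚ.- b) ≡ b ℚ.- a
  neg-diff = solve 2 (λ a b → (:- a) :- (:- b) := b :- a) refl
    where open +-*-Solver

_+ʳ_ : ℝ → ℝ → ℝ
seq    (x +ʳ y) n = seq x n ℚ.+ seq y n
cauchy (x +ʳ y) = cau
  where
  cau : Cauchy (λ n → seq x n ℚ.+ seq y n)
  cau ε ε>0 with cauchy x (½ ℚ.* ε) (½ε>0 ε>0) | cauchy y (½ ℚ.* ε) (½ε>0 ε>0)
  ... | M , p | N , q = M ⊔ N , λ m n le le′ →
    subst (λ z → ℚ.∣ z ∣ ℚ.< ε) (sym (+-diff (seq x m) (seq y m) (seq x n) (seq y n)))
      (sum-small _ _
        (p m n (ℕ.≤-trans (ℕ.m≤m⊔n M N) le) (ℕ.≤-trans (ℕ.m≤m⊔n M N) le′))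
        (q m n (ℕ.≤-trans (ℕ.m≤n⊔m M N) le) (ℕ.≤-trans (ℕ.m≤n⊔m M N) le′)))

-ʳ_ : ℝ → ℝ
seq    (-ʳ x) n = ℚ.- seq x n
cauchy (-ʳ x) = cau
  where
  cau : Cauchy (λ n → ℚ.- seq x n)
  cau ε ε>0 with cauchy x ε ε>0
  ... | N , p = N , λ m n le le′ →
    subst (λ z → ℚ.∣ z ∣ ℚ.< ε) (sym (neg-diff (seq x m) (seq x n))) (p n m le′ le)

_*ʳ_ : ℝ → ℝ → ℝ
seq    (x *ʳ y) n = seq x n ℚ.* seq y n
cauchy (x *ʳ y) = cau
  where
  cau : Cauchy (λ n → seq x n ℚ.* seq y n)
  cau ε ε>0 =
    let (B , B>0 , K , x<B) = bounded x
        (C , C>0 , L , y<C) = bounded y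
        (δ , δ>0 , xs) = product-small B>0 (½ε>0 ε>0)
        (η , η>0 , ys) = product-small C>0 (½ε>0 ε>0)
        (M , q) = cauchy y δ δ>0
        (N , p) = cauchy x η η>0
        KL = K ⊔ L
        MN = M ⊔ N
        K≤ = ℕ.≤-trans (ℕ.m≤m⊔n K L) (ℕ.m≤m⊔n KL MN)
        L≤ = ℕ.≤-trans (ℕ.m≤n⊔m K L) (ℕ.m≤m⊔n KL MN)
        M≤ = ℕ.≤-trans (ℕ.m≤m⊔n M N) (ℕ.m≤n⊔m KL MN)
        N≤ = ℕ.≤-trans (ℕ.m≤n⊔m M N) (ℕ.m≤n⊔m KL MN)
    in KL ⊔ MN , λ m n le le′ →
      subst (λ z → ℚ.∣ z ∣ ℚ.< ε) (sym (*-diff (seq x m) (seq y m) (seq x n) (seq y n)))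
        (sum-small (seq x m ℚ.* (seq y m ℚ.- seq y n)) (seq y n ℚ.* (seq x m ℚ.- seq x n))
          (xs (seq x m) (seq y m ℚ.- seq y n) (x<B m (ℕ.≤-trans K≤ le))
            (q m n (ℕ.≤-trans M≤ le) (ℕ.≤-trans M≤ le′)))
          (ys (seq y n) (seq x m ℚ.- seq x n) (y<C n (ℕ.≤-trans L≤ le′))
            (p m n (ℕ.≤-trans N≤ le) (ℕ.≤-trans N≤ le′))))

------------------------------------------------------------------------
-- ℝ is a commutative ring

pointwise : ∀ {x y} → (∀ n → seq x n ≡ seq y n) → x ≃ y
pointwise {x} {y} eq = mk≃ λ ε ε>0 → 0 , λ n _ → subst (ℚ._< ε)
  (sym (cong ℚ.∣_∣ (trans (cong (ℚ._- seq y n) (eq n)) (ℚ.+-inverseʳ (seq y n))))) ε>0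

≃-refl : ∀ {x} → x ≃ x
≃-refl = pointwise λ _ → refl

≃-sym : ∀ {x y} → x ≃ y → y ≃ x
≃-sym {x} {y} x≃y = mk≃ λ ε ε>0 →
  let (N , p) = close x≃y ε ε>0
  in N , λ n le → subst (ℚ._< ε) (∣p-q∣≡∣q-p∣ (seq x n) (seq y n)) (p n le)

≃-trans : ∀ {x y z} → x ≃ y → y ≃ z → x ≃ z
≃-trans {x} {y} {z} x≃y y≃z = mk≃ λ ε ε>0 → Eventually-∩
  (λ n p q → subst (λ w → ℚ.∣ w ∣ ℚ.< ε) (telescope (seq x n) (seq y n) (seq z n)) (sum-small _ _ p q))
  (close x≃y (½ ℚ.* ε) (½ε>0 ε>0)) (close y≃z (½ ℚ.* ε) (½ε>0 ε>0))
  where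
  telescope : ∀ a b c → (a ℚ.- b) ℚ.+ (b ℚ.- c) ≡ a ℚ.- c
  telescope = solve 3 (λ a b c → (a :- b) :+ (b :- c) := a :- c) refl
    where open +-*-Solver

+ʳ-cong : ∀ {x x′ y y′} → x ≃ x′ → y ≃ y′ → x +ʳ y ≃ x′ +ʳ y′
+ʳ-cong {x} {x′} {y} {y′} p q = mk≃ λ ε ε>0 → Eventually-∩
  (λ n a b → subst (λ z → ℚ.∣ z ∣ ℚ.< ε) (sym (+-diff (seq x n) (seq y n) (seq x′ n) (seq y′ n)))
    (sum-small _ _ a b))
  (close p (½ ℚ.* ε) (½ε>0 ε>0)) (close q (½ ℚ.* ε) (½ε>0 ε>0))

-ʳ-cong : ∀ {x y} → x ≃ y → -ʳ x ≃ -ʳ y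
-ʳ-cong {x} {y} p = mk≃ λ ε ε>0 →
  let (N , a) = close p ε ε>0
  in N , λ n le → subst (ℚ._< ε)
    (trans (∣p-q∣≡∣q-p∣ (seq x n) (seq y n)) (cong ℚ.∣_∣ (sym (neg-diff (seq x n) (seq y n)))))
    (a n le)

*ʳ-cong : ∀ {x x′ y y′} → x ≃ x′ → y ≃ y′ → x *ʳ y ≃ x′ *ʳ y′
*ʳ-cong {x} {x′} {y} {y′} p q = mk≃ λ ε ε>0 →
  let (B , B>0 , x<B) = bounded x
      (C , C>0 , y<C) = bounded y′
      (δ , δ>0 , xs) = product-small B>0 (½ε>0 ε>0)
      (η , η>0 , ys) = product-small C>0 (½ε>0 ε>0)
  in Eventually-∩
    (λ n a b → subst (λ z → ℚ.∣ z ∣ ℚ.< ε) (sym (*-diff (seq x n) (seq y n) (seq x′ n) (seq y′ n)))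
      (sum-small (seq x n ℚ.* (seq y n ℚ.- seq y′ n)) (seq y′ n ℚ.* (seq x n ℚ.- seq x′ n)) a b))
    (Eventually-∩ (λ n → xs (seq x n) (seq y n ℚ.- seq y′ n)) x<B (close q δ δ>0))
    (Eventually-∩ (λ n → ys (seq y′ n) (seq x n ℚ.- seq x′ n)) y<C (close p η η>0))

ℝ-commutativeRing : CommutativeRing 0ℓ 0ℓ
ℝ-commutativeRing = record
  { Carrier = ℝ
  ; _≈_ = _≃_
  ; _+_ = _+ʳ_
  ; _*_ = _*ʳ_
  ; -_ = -ʳ_
  ; 0# = 0ℝ
  ; 1# = 1ℝ
  ; isCommutativeRing = record
    { isRing = record
      { +-isAbelianGroup = record
        { isGroup = record
          { isMonoid = record
            { isSemigroup = record
              { isMagma = record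
                { isEquivalence = record { refl = ≃-refl ; sym = ≃-sym ; trans = ≃-trans }
                ; ∙-cong = +ʳ-cong
                }
              ; assoc = λ x y z → pointwise λ n → ℚ.+-assoc (seq x n) (seq y n) (seq z n)
              }
            ; identity = (λ x → pointwise λ n → ℚ.+-identityˡ (seq x n))
                       , (λ x → pointwise λ n → ℚ.+-identityʳ (seq x n))
            }
          ; inverse = (λ x → pointwise λ n → ℚ.+-inverseˡ (seq x n))
                    , (λ x → pointwise λ n → ℚ.+-inverseʳ (seq x n))
          ; ⁻¹-cong = -ʳ-cong
          }
        ; comm = λ x y → pointwise λ n → ℚ.+-comm (seq x n) (seq y n)
        }
      ; *-cong = *ʳ-cong
      ; *-assoc = λ x y z → pointwise λ n → ℚ.*-assoc (seq x n) (seq y n) (seq z n)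
      ; *-identity = (λ x → pointwise λ n → ℚ.*-identityˡ (seq x n))
                   , (λ x → pointwise λ n → ℚ.*-identityʳ (seq x n))
      ; distrib = (λ x y z → pointwise λ n → ℚ.*-distribˡ-+ (seq x n) (seq y n) (seq z n))
                , (λ x y z → pointwise λ n → ℚ.*-distribʳ-+ (seq x n) (seq y n) (seq z n))
      }
    ; *-comm = λ x y → pointwise λ n → ℚ.*-comm (seq x n) (seq y n)
    }
  }

------------------------------------------------------------------------
-- Square roots of natural numbers

⌊√_⌋ : ℕ → ℕ
⌊√ zero  ⌋ = 0
⌊√ suc a ⌋ with suc ⌊√ a ⌋ ℕ.* suc ⌊√ a ⌋ ℕ.≤? suc a
... | yes _ = suc ⌊√ a ⌋
... | no  _ = ⌊√ a ⌋

⌊√⌋-lower : ∀ a → ⌊√ a ⌋ ℕ.* ⌊√ a ⌋ ℕ.≤ a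
⌊√⌋-lower zero = ℕ.z≤n
⌊√⌋-lower (suc a) with suc ⌊√ a ⌋ ℕ.* suc ⌊√ a ⌋ ℕ.≤? suc a
... | yes le = le
... | no  _  = ℕ.m≤n⇒m≤1+n (⌊√⌋-lower a)

⌊√⌋-upper : ∀ a → a ℕ.< suc ⌊√ a ⌋ ℕ.* suc ⌊√ a ⌋
⌊√⌋-upper zero = ℕ.z<s
⌊√⌋-upper (suc a) with suc ⌊√ a ⌋ ℕ.* suc ⌊√ a ⌋ ℕ.≤? suc a
... | yes _ = ℕ.≤-<-trans (⌊√⌋-upper a) (ℕ.*-mono-< (ℕ.n<1+n (suc ⌊√ a ⌋)) (ℕ.n<1+n (suc ⌊√ a ⌋)))
... | no gt = ℕ.≰⇒> gt

private
  toℚᵘ-/ : ∀ a b → ℚ.toℚᵘ (+ a ℚ./ suc b) ℚᵘ.≃ ℚᵘ.mkℚᵘ (+ a) b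
  toℚᵘ-/ a b = ℚ.toℚᵘ-fromℚᵘ (ℚᵘ.mkℚᵘ (+ a) b)

  /-<-/ : ∀ a b c d → a ℕ.* suc d ℕ.< c ℕ.* suc b → + a ℚ./ suc b ℚ.< + c ℚ./ suc d
  /-<-/ a b c d lt = ℚ.toℚᵘ-cancel-<
    (ℚᵘ.<-respˡ-≃ (ℚᵘ.≃-sym (toℚᵘ-/ a b)) (ℚᵘ.<-respʳ-≃ (ℚᵘ.≃-sym (toℚᵘ-/ c d))
      (ℚᵘ.*<* (subst₂ ℤ._<_ (ℤ.pos-* a (suc d)) (ℤ.pos-* c (suc b)) (+<+ lt)))))

  /-≤-/ : ∀ a b c d → a ℕ.* suc d ℕ.≤ c ℕ.* suc b → + a ℚ./ suc b ℚ.≤ + c ℚ./ suc d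
  /-≤-/ a b c d le = ℚ.toℚᵘ-cancel-≤
    (ℚᵘ.≤-respˡ-≃ (ℚᵘ.≃-sym (toℚᵘ-/ a b)) (ℚᵘ.≤-respʳ-≃ (ℚᵘ.≃-sym (toℚᵘ-/ c d))
      (ℚᵘ.*≤* (subst₂ ℤ._≤_ (ℤ.pos-* a (suc d)) (ℤ.pos-* c (suc b)) (+≤+ le)))))

  /-+-/ : ∀ a b c → + a ℚ./ suc c ℚ.+ + b ℚ./ suc c ≡ + (a ℕ.+ b) ℚ./ suc c
  /-+-/ a b c = ℚ.toℚᵘ-injective (begin-equality
    ℚ.toℚᵘ (+ a ℚ./ suc c ℚ.+ + b ℚ./ suc c)
      ≃⟨ ℚ.toℚᵘ-homo-+ (+ a ℚ./ suc c) (+ b ℚ./ suc c) ⟩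
    ℚ.toℚᵘ (+ a ℚ./ suc c) ℚᵘ.+ ℚ.toℚᵘ (+ b ℚ./ suc c)
      ≃⟨ ℚᵘ.+-cong (toℚᵘ-/ a c) (toℚᵘ-/ b c) ⟩
    ℚᵘ.mkℚᵘ (+ a) c ℚᵘ.+ ℚᵘ.mkℚᵘ (+ b) c
      ≃⟨ ℚᵘ.*≡* eq ⟩
    ℚᵘ.mkℚᵘ (+ (a ℕ.+ b)) c
      ≃⟨ toℚᵘ-/ (a ℕ.+ b) c ⟨
    ℚ.toℚᵘ (+ (a ℕ.+ b) ℚ./ suc c) ∎)
    where
    open ℚᵘ.≤-Reasoning
    eq : (+ a ℤ.* + suc c ℤ.+ + b ℤ.* + suc c) ℤ.* + suc c ≡ + (a ℕ.+ b) ℤ.* + (suc c ℕ.* suc c)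
    eq = trans (cong (ℤ._* + suc c) (sym (ℤ.*-distribʳ-+ (+ suc c) (+ a) (+ b))))
           (trans (ℤ.*-assoc (+ a ℤ.+ + b) (+ suc c) (+ suc c))
             (cong₂ ℤ._*_ (sym (ℤ.pos-+ a b)) (sym (ℤ.pos-* (suc c) (suc c)))))

  /-*-/ : ∀ a b c → (+ a ℚ./ suc c) ℚ.* (+ b ℚ./ suc c) ≡ + (a ℕ.* b) ℚ./ (suc c ℕ.* suc c)
  /-*-/ a b c = ℚ.toℚᵘ-injective (begin-equality
    ℚ.toℚᵘ ((+ a ℚ./ suc c) ℚ.* (+ b ℚ./ suc c))
      ≃⟨ ℚ.toℚᵘ-homo-* (+ a ℚ./ suc c) (+ b ℚ./ suc c) ⟩
    ℚ.toℚᵘ (+ a ℚ./ suc c) ℚᵘ.* ℚ.toℚᵘ (+ b ℚ./ suc c)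
      ≃⟨ ℚᵘ.*-cong (toℚᵘ-/ a c) (toℚᵘ-/ b c) ⟩
    ℚᵘ.mkℚᵘ (+ a) c ℚᵘ.* ℚᵘ.mkℚᵘ (+ b) c
      ≃⟨ ℚᵘ.*≡* (cong (ℤ._* + (suc c ℕ.* suc c)) (sym (ℤ.pos-* a b))) ⟩
    ℚᵘ.mkℚᵘ (+ (a ℕ.* b)) (c ℕ.+ c ℕ.* suc c)
      ≃⟨ toℚᵘ-/ (a ℕ.* b) (c ℕ.+ c ℕ.* suc c) ⟨
    ℚ.toℚᵘ (+ (a ℕ.* b) ℚ./ (suc c ℕ.* suc c)) ∎)
    where open ℚᵘ.≤-Reasoning

  /-cancel : ∀ a c → + (a ℕ.* suc c) ℚ./ (suc c ℕ.* suc c) ≡ + a ℚ./ suc c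
  /-cancel a c = ℚ.toℚᵘ-injective (begin-equality
    ℚ.toℚᵘ (+ (a ℕ.* suc c) ℚ./ (suc c ℕ.* suc c))
      ≃⟨ toℚᵘ-/ (a ℕ.* suc c) (c ℕ.+ c ℕ.* suc c) ⟩
    ℚᵘ.mkℚᵘ (+ (a ℕ.* suc c)) (c ℕ.+ c ℕ.* suc c)
      ≃⟨ ℚᵘ.*≡* eq ⟩
    ℚᵘ.mkℚᵘ (+ a) c
      ≃⟨ toℚᵘ-/ a c ⟨
    ℚ.toℚᵘ (+ a ℚ./ suc c) ∎)
    where
    open ℚᵘ.≤-Reasoning
    eq : + (a ℕ.* suc c) ℤ.* + suc c ≡ + a ℤ.* + (suc c ℕ.* suc c)
    eq = trans (sym (ℤ.pos-* (a ℕ.* suc c) (suc c)))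
           (trans (cong +_ (ℕ.*-assoc a (suc c) (suc c))) (ℤ.pos-* a (suc c ℕ.* suc c)))

  archimedean : ∀ c {ε} → 0ℚ ℚ.< ε → Eventually λ n → + c ℚ./ suc n ℚ.< ε
  archimedean c {ε} ε>0 = go ε (ℚ.positive ε>0)
    where
    go : ∀ ε → ℚ.Positive ε → Eventually λ n → + c ℚ./ suc n ℚ.< ε
    go (ℚ.mkℚ (+ suc p) q cop) _ = c ℕ.* suc q , λ n le → ℚ.toℚᵘ-cancel-<
      (ℚᵘ.<-respˡ-≃ (ℚᵘ.≃-sym (toℚᵘ-/ c n))
        (ℚᵘ.*<* (subst₂ ℤ._<_ (ℤ.pos-* c (suc q)) (ℤ.pos-* (suc p) (suc n))
          (+<+ (ℕ.≤-trans (ℕ.s≤s le) (ℕ.m≤m+n (suc n) (p ℕ.* suc n)))))))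

  ∣-∣-bound : ∀ {p q ε} → p ℚ.< q ℚ.+ ε → q ℚ.< p ℚ.+ ε → ℚ.∣ p ℚ.- q ∣ ℚ.< ε
  ∣-∣-bound {p} {q} {ε} p< q< with ℚ.∣p∣≡p∨∣p∣≡-p (p ℚ.- q)
  ... | inj₁ eq = subst₂ ℚ._<_ (sym eq)
        (solve 2 (λ q e → q :+ e :- q := e) refl q ε) (ℚ.+-monoˡ-< (ℚ.- q) p<)
    where open +-*-Solver
  ... | inj₂ eq = subst₂ ℚ._<_ (trans (solve 2 (λ p q → q :- p := :- (p :- q)) refl p q) (sym eq))
        (solve 2 (λ p e → p :+ e :- p := e) refl p ε) (ℚ.+-monoˡ-< (ℚ.- p) q<)
    where open +-*-Solver

-- The largest fraction with denominator n + 1 whose square is at most a.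
√-seq : ℕ → ℕ → ℚ
√-seq a n = + ⌊√ a ℕ.* (suc n ℕ.* suc n) ⌋ ℚ./ suc n

private
  √-seq-step : ∀ a m n → √-seq a m ℚ.< √-seq a n ℚ.+ + 1 ℚ./ suc n
  √-seq-step a m n = subst (√-seq a m ℚ.<_)
    (trans (cong (λ t → + t ℚ./ N) (ℕ.+-comm 1 s)) (sym (/-+-/ s 1 n)))
    (/-<-/ r m (suc s) n (ℕ.≰⇒> λ le → ℕ.<-irrefl refl (begin-strict
      (suc s ℕ.* M) ℕ.* (suc s ℕ.* M)    ≤⟨ ℕ.*-mono-≤ le le ⟩
      (r ℕ.* N) ℕ.* (r ℕ.* N)            ≡⟨ swap r N ⟩
      (r ℕ.* r) ℕ.* (N ℕ.* N)            ≤⟨ ℕ.*-monoˡ-≤ (N ℕ.* N) (⌊√⌋-lower (a ℕ.* (M ℕ.* M))) ⟩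
      (a ℕ.* (M ℕ.* M)) ℕ.* (N ℕ.* N)    ≡⟨ exchange a (M ℕ.* M) (N ℕ.* N) ⟩
      (a ℕ.* (N ℕ.* N)) ℕ.* (M ℕ.* M)    <⟨ ℕ.*-monoˡ-< (M ℕ.* M) (⌊√⌋-upper (a ℕ.* (N ℕ.* N))) ⟩
      (suc s ℕ.* suc s) ℕ.* (M ℕ.* M)    ≡⟨ swap (suc s) M ⟨
      (suc s ℕ.* M) ℕ.* (suc s ℕ.* M)    ∎)))
    where
    open ℕ.≤-Reasoning
    M N r s : ℕ
    M = suc m
    N = suc n
    r = ⌊√ a ℕ.* (M ℕ.* M) ⌋
    s = ⌊√ a ℕ.* (N ℕ.* N) ⌋
    swap : ∀ x y → (x ℕ.* y) ℕ.* (x ℕ.* y) ≡ (x ℕ.* x) ℕ.* (y ℕ.* y)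
    swap = solve-∀
    exchange : ∀ x y z → (x ℕ.* y) ℕ.* z ≡ (x ℕ.* z) ℕ.* y
    exchange = solve-∀

  √-seq-cauchy : ∀ a → Cauchy (√-seq a)
  √-seq-cauchy a ε ε>0 =
    let (N , small) = archimedean 1 ε>0
        near m n N≤n = ℚ.<-trans (√-seq-step a m n) (ℚ.+-monoʳ-< (√-seq a n) (small n N≤n))
    in N , λ m n N≤m N≤n → ∣-∣-bound (near m n N≤n) (near n m N≤m)

infix 9 √_

√_ : ℕ → ℝ
seq    (√ a) = √-seq a
cauchy (√ a) = √-seq-cauchy a

√-nonneg : ∀ a → 0ℝ ≤ʳ √ a
√-nonneg a = mk≤ λ ε ε>0 → 0 , λ n _ → ℚ.+-mono-≤-< (0≤√-seq n) ε>0
  where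
  0≤√-seq : ∀ n → 0ℚ ℚ.≤ √-seq a n
  0≤√-seq n = ℚ.nonNegative⁻¹ _ {{ℚ.normalize-nonNeg ⌊√ a ℕ.* (suc n ℕ.* suc n) ⌋ (suc n)}}

√-square : ∀ a → √ a *ʳ √ a ≃ fromℕ a
√-square a = mk≃ λ ε ε>0 →
  let (N , small) = archimedean (suc (2 ℕ.* a)) ε>0
  in N , λ n N≤n → ∣-∣-bound (upper n ε>0)
       (ℚ.<-trans (lower n) (ℚ.+-monoʳ-< (√-seq a n ℚ.* √-seq a n) (small n N≤n)))
  where
  open ℕ.≤-Reasoning
  M r D : ℕ → ℕ
  M n = suc n
  r n = ⌊√ a ℕ.* (M n ℕ.* M n) ⌋
  D n = n ℕ.+ n ℕ.* suc n

  square : ∀ n → √-seq a n ℚ.* √-seq a n ≡ + (r n ℕ.* r n) ℚ./ suc (D n)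
  square n = /-*-/ (r n) (r n) n

  upper : ∀ n {ε} → 0ℚ ℚ.< ε → √-seq a n ℚ.* √-seq a n ℚ.< + a ℚ./ 1 ℚ.+ ε
  upper n {ε} ε>0 = subst₂ ℚ._<_ (trans (ℚ.+-identityʳ _) (sym (square n))) refl
    (ℚ.+-mono-≤-< (/-≤-/ (r n ℕ.* r n) (D n) a 0
      (subst (ℕ._≤ a ℕ.* suc (D n)) (sym (ℕ.*-identityʳ (r n ℕ.* r n)))
        (⌊√⌋-lower (a ℕ.* (M n ℕ.* M n))))) ε>0)

  r≤aM : ∀ n → r n ℕ.≤ a ℕ.* M n
  r≤aM n = ℕ.≮⇒≥ λ aM<r → ℕ.<-irrefl refl (begin-strict
    r n ℕ.* r n                      ≤⟨ ⌊√⌋-lower (a ℕ.* (M n ℕ.* M n)) ⟩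
    a ℕ.* (M n ℕ.* M n)              ≡⟨ ℕ.*-assoc a (M n) (M n) ⟨
    (a ℕ.* M n) ℕ.* M n              ≤⟨ aM·M≤ a n ⟩
    (a ℕ.* M n) ℕ.* (a ℕ.* M n)      <⟨ ℕ.*-mono-< aM<r aM<r ⟩
    r n ℕ.* r n                      ∎)
    where
    aM·M≤ : ∀ a n → (a ℕ.* suc n) ℕ.* suc n ℕ.≤ (a ℕ.* suc n) ℕ.* (a ℕ.* suc n)
    aM·M≤ zero    n = ℕ.z≤n
    aM·M≤ (suc a) n = ℕ.*-monoʳ-≤ (suc a ℕ.* suc n) (ℕ.m≤m+n (suc n) (a ℕ.* suc n))

  gap-bound : ∀ n → a ℕ.* (M n ℕ.* M n) ℕ.< r n ℕ.* r n ℕ.+ suc (2 ℕ.* a) ℕ.* M n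
  gap-bound n = begin-strict
    a ℕ.* (M n ℕ.* M n)                            <⟨ ⌊√⌋-upper (a ℕ.* (M n ℕ.* M n)) ⟩
    suc (r n) ℕ.* suc (r n)                        ≡⟨ expand (r n) ⟩
    r n ℕ.* r n ℕ.+ (1 ℕ.+ 2 ℕ.* r n)              ≤⟨ ℕ.+-monoʳ-≤ (r n ℕ.* r n)
                                                        (ℕ.+-mono-≤ {1} {M n} (ℕ.s≤s ℕ.z≤n) (ℕ.*-monoʳ-≤ 2 (r≤aM n))) ⟩
    r n ℕ.* r n ℕ.+ (M n ℕ.+ 2 ℕ.* (a ℕ.* M n))    ≡⟨ cong (λ t → r n ℕ.* r n ℕ.+ (M n ℕ.+ t)) (ℕ.*-assoc 2 a (M n)) ⟨
    r n ℕ.* r n ℕ.+ suc (2 ℕ.* a) ℕ.* M n          ∎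
    where
    expand : ∀ x → suc x ℕ.* suc x ≡ x ℕ.* x ℕ.+ (1 ℕ.+ 2 ℕ.* x)
    expand = solve-∀

  lower : ∀ n → + a ℚ./ 1 ℚ.< √-seq a n ℚ.* √-seq a n ℚ.+ + suc (2 ℕ.* a) ℚ./ suc n
  lower n = subst (+ a ℚ./ 1 ℚ.<_)
    (trans (sym (/-+-/ (r n ℕ.* r n) (suc (2 ℕ.* a) ℕ.* M n) (D n)))
      (cong₂ ℚ._+_ (sym (square n)) (/-cancel (suc (2 ℕ.* a)) n)))
    (/-<-/ a 0 (r n ℕ.* r n ℕ.+ suc (2 ℕ.* a) ℕ.* M n) (D n)
      (subst (a ℕ.* suc (D n) ℕ.<_) (sym (ℕ.*-identityʳ _)) (gap-bound n)))

------------------------------------------------------------------------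
-- Finite simple graphs

record Graph : Set₁ where
  infix 4 _~_ _~?_
  field
    Vertex   : Set
    _~_      : Rel Vertex 0ℓ
    _~?_     : Decidable _~_
    ~-sym    : ∀ {u v} → u ~ v → v ~ u
    ~-irrefl : ∀ {v} → ¬ (v ~ v)
    vertices : List Vertex
    complete : ∀ v → v ∈ vertices
    unique   : Unique vertices

  order : ℕ
  order = length vertices

module _ {A : Set} {P : A → Set} (P? : Unary.Decidable P) where

  refine-list : List A → List [ x ∈ A ∣ P x ]
  refine-list [] = []
  refine-list (x ∷ xs) with P? x
  ... | yes p = (x , [ p ]) ∷ refine-list xs
  ... | no  _ = refine-list xs

  refine-∈ : ∀ {xs} x .(p : P x) → x ∈ xs → (x , [ p ]) ∈ refine-list xs
  refine-∈ {y ∷ _} x p (here refl) with P? y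
  ... | yes _ = here refl
  ... | no ¬p = contradiction-irr p ¬p
  refine-∈ {y ∷ _} x p (there i) with P? y
  ... | yes _ = there (refine-∈ x p i)
  ... | no  _ = refine-∈ x p i

  refine-≢ : ∀ {x xs} .(p : P x) → All (x ≢_) xs → All ((x , [ p ]) ≢_) (refine-list xs)
  refine-≢ p [] = []
  refine-≢ {xs = y ∷ _} p (x≢y ∷ rest) with P? y
  ... | yes _ = (x≢y ∘ cong value) ∷ refine-≢ p rest
  ... | no  _ = refine-≢ p rest

  refine-unique : ∀ {xs} → Unique xs → Unique (refine-list xs)
  refine-unique [] = []
  refine-unique {x ∷ _} (x≢ ∷ rest) with P? x
  ... | yes p = refine-≢ p x≢ ∷ refine-unique rest
  ... | no  _ = refine-unique rest

induced : (G : Graph) {P : Graph.Vertex G → Set} → Unary.Decidable P → Graph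
induced G {P} P? = record
  { Vertex   = [ v ∈ Vertex ∣ P v ]
  ; _~_      = _~_ on value
  ; _~?_     = λ u v → value u ~? value v
  ; ~-sym    = ~-sym
  ; ~-irrefl = ~-irrefl
  ; vertices = refine-list P? vertices
  ; complete = λ { (v , [ p ]) → refine-∈ P? v p (complete v) }
  ; unique   = refine-unique P? unique
  }
  where open Graph G

------------------------------------------------------------------------
-- The Boolean lattice and its consecutive levels

infixl 6 _△_

_△_ : ∀ {n} → Subset n → Subset n → Subset n
U △ W = (U ─ W) ∪ (W ─ U)

subsets : ∀ n → List (Subset n)
subsets zero    = [] ∷ []
subsets (suc n) = map (outside ∷_) (subsets n) ++ map (inside ∷_) (subsets n)

private
  subsets-complete : ∀ {n} (U : Subset n) → U ∈ subsets n
  subsets-complete []            = here refl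
  subsets-complete (outside ∷ U) = ∈-++⁺ˡ (∈-map⁺ (outside ∷_) (subsets-complete U))
  subsets-complete (inside  ∷ U) = ∈-++⁺ʳ _ (∈-map⁺ (inside ∷_) (subsets-complete U))

  subsets-unique : ∀ n → Unique (subsets n)
  subsets-unique zero    = [] ∷ []
  subsets-unique (suc n) = Unique.++⁺
    (Unique.map⁺ Vec.∷-injectiveʳ (subsets-unique n))
    (Unique.map⁺ Vec.∷-injectiveʳ (subsets-unique n))
    λ (i , j) → disjoint (∈-map⁻ (outside ∷_) i) (∈-map⁻ (inside ∷_) j)
    where
    disjoint : ∀ {V} → ∃[ U ] U ∈ subsets n × V ≡ outside ∷ U →
               ¬ (∃[ W ] W ∈ subsets n × V ≡ inside ∷ W)
    disjoint (_ , _ , refl) (_ , _ , ())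

  ∣U△U∣≡0 : ∀ {n} (U : Subset n) → ∣ U △ U ∣ ≡ 0
  ∣U△U∣≡0 []            = refl
  ∣U△U∣≡0 (outside ∷ U) = ∣U△U∣≡0 U
  ∣U△U∣≡0 (inside  ∷ U) = ∣U△U∣≡0 U

BL : ℕ → Graph
BL n = record
  { Vertex   = Subset n
  ; _~_      = λ U W → ∣ U △ W ∣ ≡ 1
  ; _~?_     = λ U W → ∣ U △ W ∣ ℕ.≟ 1
  ; ~-sym    = λ {U} {W} → trans (cong ∣_∣ (∪-comm (W ─ U) (U ─ W)))
  ; ~-irrefl = λ {U} eq → contradiction (trans (sym (∣U△U∣≡0 U)) eq) λ ()
  ; vertices = subsets n
  ; complete = subsets-complete
  ; unique   = subsets-unique n
  }

-- For k = 0 the truncated k ∸ 1 would be 0; only k ≥ 1 is meaningful.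
BL-levels : ℕ → ℕ → Graph
BL-levels n k = induced (BL n) {λ U → ∣ U ∣ ≡ k ∸ 1 ⊎ ∣ U ∣ ≡ k}
  λ U → (∣ U ∣ ℕ.≟ k ∸ 1) ⊎-dec (∣ U ∣ ℕ.≟ k)

------------------------------------------------------------------------
-- Spectra

open import Algebra.Properties.CommutativeMonoid.Sum
  (CommutativeRing.+-commutativeMonoid ℝ-commutativeRing) using () renaming (sum to ∑)

module Spectrum (G : Graph) where
  open Graph G

  Vector : Set
  Vector = Vertex → ℝ

  Matrix : Set
  Matrix = Vertex → Vertex → ℝ

  infix  4 _≋_
  infixr 7 _·_ _•_

  _≋_ : Rel Vector 0ℓ
  v ≋ w = ∀ x → v x ≃ w x

  _•_ : ℝ → Vector → Vector
  (μ • v) x = μ *ʳ v x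

  _·_ : Matrix → Vector → Vector
  (M · v) x = foldr _+ʳ_ 0ℝ (map (λ y → M x y *ʳ v y) vertices)

  adjacency : Matrix
  adjacency x y = if ⌊ x ~? y ⌋ then 1ℝ else 0ℝ

  Eigenspace : Matrix → ℝ → Vector → Set
  Eigenspace M μ v = M · v ≋ μ • v

  -- v x # 0ℝ for some x is the positive form of v ≠ 0.
  IsEigenvalue : Matrix → ℝ → Set
  IsEigenvalue M μ = ∃[ v ] Eigenspace M μ v × (∃[ x ] v x # 0ℝ)

  combination : ∀ {m} → (Fin m → ℝ) → (Fin m → Vector) → Vector
  combination c b x = ∑ λ i → c i *ʳ b i x

  record IsBasis (S : Vector → Set) {m : ℕ} (b : Fin m → Vector) : Set where
    field
      members     : ∀ i → S (b i)
      independent : ∀ c → combination c b ≋ (λ _ → 0ℝ) → ∀ i → c i ≃ 0ℝ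
      spanning    : ∀ v → S v → ∃[ c ] v ≋ combination c b

  HasDimension : (Vector → Set) → ℕ → Set
  HasDimension S m = ∃[ b ] IsBasis S {m} b

  -- A spectrum is presented as a list of distinct numbers with their
  -- multiplicities; entries with multiplicity 0 are harmless, as the
  -- corresponding eigenspace is then zero. Multiplicities are dimensions of
  -- eigenspaces; since they are required to add up to the size of the matrix,
  -- they are also the multiplicities of the roots of the characteristic
  -- polynomial.
  record IsSpectrum (M : Matrix) (Λ : List (ℝ × ℕ)) : Set where
    field
      distinct       : AllPairs (_#_ on proj₁) Λ
      multiplicities : All (λ (μ , m) → HasDimension (Eigenspace M μ) m) Λ
      exhaustive     : ∀ μ → IsEigenvalue M μ → Any (λ (ν , _) → μ ≃ ν) Λ
      total          : sum (map proj₂ Λ) ≡ order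

HasSpectrum : Graph → List (ℝ × ℕ) → Set
HasSpectrum G = IsSpectrum adjacency
  where open Spectrum G

------------------------------------------------------------------------
-- The claimed eigenvalues and multiplicities

-- C(n , j) - C(n , j - 1), with C(n , -1) = 0. The subtraction does not
-- truncate for 2 j ≤ n + 1.
binomial-difference : ℕ → ℕ → ℕ
binomial-difference n zero    = n C 0
binomial-difference n (suc j) = n C suc j ∸ n C j

±-eigenvalues : ℕ → ℕ → ℕ → List (ℝ × ℕ)
±-eigenvalues n k j = (√ a , m) ∷ (-ʳ √ a , m) ∷ []
  where
  a m : ℕ
  a = (k ∸ j) ℕ.* (n ∸ k ℕ.+ 1 ∸ j)
  m = binomial-difference n j

{-# OPTIONS --safe #-}
module Submission where

-- Let D and U sum a function on subsets over the upper, respectively lower,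
-- covers. On level i one has D U = U D + (n - 2 i), so D maps an eigenvector of
-- D U on level i to one on level i - 1, with the eigenvalue lowered by n - 2 i;
-- going down to level 0 shows that level k - 1 only carries the eigenvalues
-- (k - j)(n - k + 1 - j), and that the eigenspace for j is U^(k-1-j) applied to
-- the harmonic functions (the kernel of D) of level j. The latter have dimension
-- C(n, j) - C(n, j - 1) by a Pascal recursion obtained from splitting off one
-- element. Since the adjacency operator sends (f, g) to (D g, U f), its
-- eigenvectors for μ ≠ 0 are the pairs (f, U f / μ) with D U f = μ² f, and for
-- μ = 0 the pairs (0, g) with g harmonic.

open import Algebra.Bundles using (CommutativeRing)
import Algebra.Properties.CommutativeMonoid.Sum as CommutativeMonoidSum
import Algebra.Properties.CommutativeSemigroup as CommutativeSemigroup
open import Data.Bool.Base using (Bool; true; false; if_then_else_)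
open import Data.Fin.Base using (Fin; zero; suc; _↑ˡ_; _↑ʳ_; splitAt; join)
open import Data.Fin.Properties using (join-splitAt)
open import Data.Fin.Subset using (Subset; inside; outside; ∣_∣; ∁; ⊥)
open import Data.Fin.Subset.Properties using (∣∁p∣≡n∸∣p∣; ∣p∣≤n; ∣⊥∣≡0)
open import Data.Integer.Base as ℤ using (+_)
import Data.Integer.Properties as ℤ
open import Data.Irrelevant using ([_])
open import Data.List.Base using (List; []; _∷_; _++_; map; foldr; length; filter; concatMap; upTo)
import Data.List.Properties as List
open import Data.List.Relation.Unary.All as All using (All; []; _∷_)
import Data.List.Relation.Unary.All.Properties as All
open import Data.List.Relation.Unary.AllPairs using (AllPairs; []; _∷_)
import Data.List.Relation.Unary.AllPairs.Properties as AllPairs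
open import Data.List.Relation.Unary.Any using (Any; here; there)
open import Data.Nat.Base as ℕ using (ℕ; zero; suc; z≤n; s≤s; _*_; _∸_; _≥_)
open import Data.Nat.Combinatorics using (_C_; nCn≡1; nCk≡nC[n∸k]; nCk+nC[k+1]≡[n+1]C[k+1])
open import Data.Nat.ListAction using (sum)
open import Data.Nat.ListAction.Properties using (sum-++)
import Data.Nat.Properties as ℕ
open import Data.Nat.Tactic.RingSolver using (solve-∀)
open import Data.Product.Base using (∃-syntax; _×_; _,_; proj₁; proj₂)
open import Data.Rational.Base as ℚ using (ℚ; 0ℚ; 1ℚ; ½)
import Data.Rational.Properties as ℚ
open import Data.Rational.Solver using (module +-*-Solver)
import Data.Rational.Unnormalised.Base as ℚᵘ
import Data.Rational.Unnormalised.Properties as ℚᵘ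
open import Data.Refinement.Base using (Refinement-syntax; value; _,_)
open import Data.Sum.Base using (_⊎_; inj₁; inj₂; [_,_]′)
open import Data.Vec.Base using ([]; _∷_)
import Data.Vec.Functional as Vector
open import Data.Vec.Functional.Properties using (lookup-++ˡ; lookup-++ʳ)
open import Function.Base using (_∘_; _on_)
open import Relation.Binary.Definitions using (tri<; tri≈; tri>)
open import Relation.Binary.PropositionalEquality as ≡ using (_≡_; _≢_; refl; cong; cong₂; subst)
import Relation.Binary.Reasoning.Setoid as SetoidReasoning
open import Relation.Nullary.Decidable.Core using (yes; no; does; ⌊_⌋; recompute; _⊎-dec_)
open import Relation.Nullary.Negation.Core using (¬_; contradiction)
import Relation.Unary as Unary
open import Defs

open +-*-Solver using (solve; con; _:=_; _:+_; _:*_; _:-_; :-_)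
open CommutativeRing ℝ-commutativeRing using
  ( setoid; _-_; +-congˡ; +-congʳ; *-congˡ; *-congʳ; +-identityˡ; +-identityʳ; *-identityˡ; *-identityʳ
  ; zeroˡ; zeroʳ; -‿inverseˡ; -‿inverseʳ; +-comm; *-comm; +-assoc; *-assoc; distribˡ; distribʳ
  ; +-commutativeMonoid; +-commutativeSemigroup; *-commutativeSemigroup )
open CommutativeSemigroup *-commutativeSemigroup using (x∙yz≈y∙xz)
open CommutativeSemigroup +-commutativeSemigroup using (xy∙z≈xz∙y; x∙yz≈y∙zx; interchange)
open CommutativeMonoidSum +-commutativeMonoid using (sum-cong-≋) renaming (sum to ∑)

-- Equality of Cauchy reals is not decidable, so "non-zero" appears in two positive forms: apartness
-- `_#_` and cancellability `Regular`. Division in `ℝ` is only by natural numbers; √a is inverted as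
-- √a / a. Exhaustiveness cannot be shown by testing μ against the list: a μ apart from every entry
-- is shown not to be an eigenvalue, and the entry equal to μ is then extracted from the pairwise
-- apartness of the list. With i = k - 1, the hypothesis on n becomes n = 2i + 1 + d for a natural
-- d. Subtractions turn into additions, and the positivity of n - 2i, on which the injectivity of
-- `U` on level i rests, is carried by the constructor `suc`. The delicate case of the Pascal
-- recursion is level j + 1 over 2j + 1 elements: splitting off an element leaves n = 2j, and the
-- correction term would divide by n - 2j = 0. There the harmonic functions vanish, because
-- complementation turns `D` between the two middle levels into the injective `U`.

module ≃-Reasoning = SetoidReasoning setoid

-- Apartness on ℝ

½>0 : ∀ {ε} → 0ℚ ℚ.< ε → 0ℚ ℚ.< ½ ℚ.* ε
½>0 {ε} ε>0 = ℚ.positive⁻¹ _ {{ℚ.pos*pos⇒pos ½ ε {{ℚ.positive ε>0}}}}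

halves : ∀ ε → ½ ℚ.* ε ℚ.+ ½ ℚ.* ε ≡ ε
halves ε = ≡.trans (≡.sym (ℚ.*-distribʳ-+ ε ½ ½)) (ℚ.*-identityˡ ε)

∣∣-sum< : ∀ {a b} u v → ℚ.∣ u ∣ ℚ.< a → ℚ.∣ v ∣ ℚ.< b → ℚ.∣ u ℚ.+ v ∣ ℚ.< a ℚ.+ b
∣∣-sum< u v u< v< = ℚ.≤-<-trans (ℚ.∣p+q∣≤∣p∣+∣q∣ u v) (ℚ.+-mono-< u< v<)

-- A single rational comparison decides. Past the index `N` the difference oscillates by less than
-- ε/4; if it is below ε/2 at `N` it stays below ε, otherwise it stays at least ε/4.
near-or-apart : ∀ x y {ε} → 0ℚ ℚ.< ε →
                x # y ⊎ Eventually λ n → ℚ.∣ seq x n ℚ.- seq y n ∣ ℚ.< ε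
near-or-apart x y {ε} ε>0 = decide (cauchy (x - y) η η>0)
  where
  δ η : ℚ
  δ = ½ ℚ.* ε
  η = ½ ℚ.* δ
  δ>0 : 0ℚ ℚ.< δ
  δ>0 = ½>0 ε>0
  η>0 : 0ℚ ℚ.< η
  η>0 = ½>0 δ>0
  η<δ : η ℚ.< δ
  η<δ = ≡.subst₂ ℚ._<_ (ℚ.+-identityʳ η) (halves δ) (ℚ.+-monoʳ-< η η>0)
  z : ℕ → ℚ
  z n = seq x n ℚ.- seq y n
  far : ∀ {p q} → δ ℚ.≤ ℚ.∣ p ∣ → ℚ.∣ p ℚ.- q ∣ ℚ.< η → η ℚ.≤ ℚ.∣ q ∣
  far {p} {q} large osc = ℚ.<⇒≤ (≡.subst₂ ℚ._<_ (cancel η) (cancel ℚ.∣ q ∣) (ℚ.+-monoˡ-< (ℚ.- η) (begin-strict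
      η ℚ.+ η                       ≡⟨ halves δ ⟩
      δ                             ≤⟨ large ⟩
      ℚ.∣ p ∣                       ≡⟨ cong ℚ.∣_∣ (solve 2 (λ a b → a := b :+ (a :- b)) refl p q) ⟩
      ℚ.∣ q ℚ.+ (p ℚ.- q) ∣         ≤⟨ ℚ.∣p+q∣≤∣p∣+∣q∣ q (p ℚ.- q) ⟩
      ℚ.∣ q ∣ ℚ.+ ℚ.∣ p ℚ.- q ∣     <⟨ ℚ.+-monoʳ-< ℚ.∣ q ∣ osc ⟩
      ℚ.∣ q ∣ ℚ.+ η                 ∎)))
    where
    open ℚ.≤-Reasoning
    cancel : ∀ a → a ℚ.+ η ℚ.- η ≡ a
    cancel a = solve 2 (λ a b → a :+ b :- b := a) refl a η
  near : ∀ {p q} → ℚ.∣ p ∣ ℚ.< δ → ℚ.∣ q ℚ.- p ∣ ℚ.< η → ℚ.∣ q ∣ ℚ.< ε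
  near {p} {q} small osc = ≡.subst₂ ℚ._<_
    (cong ℚ.∣_∣ (solve 2 (λ a b → a :+ (b :- a) := b) refl p q)) (halves ε)
    (∣∣-sum< p (q ℚ.- p) small (ℚ.<-trans osc η<δ))
  decide : (∃[ N ] ∀ m n → N ℕ.≤ m → N ℕ.≤ n → ℚ.∣ z m ℚ.- z n ∣ ℚ.< η) →
           x # y ⊎ Eventually λ n → ℚ.∣ z n ∣ ℚ.< ε
  decide (N , osc) with ℚ.∣ z N ∣ ℚ.<? δ
  ... | yes small = inj₂ (N , λ n le → near small (osc n N le ℕ.≤-refl))
  ... | no  large = inj₁ (mk# η η>0 (N , λ n le → far (ℚ.≮⇒≥ large) (osc N n ℕ.≤-refl le)))

#-tight : ∀ {x y} → ¬ (x # y) → x ≃ y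
#-tight {x} {y} ¬x#y = mk≃ λ ε ε>0 →
  [ (λ x#y → contradiction x#y ¬x#y) , (λ near → near) ]′ (near-or-apart x y ε>0)

eventually-true : ∀ {P} {A : Set} → Eventually P → (∀ n → P n → A) → A
eventually-true (N , p) f = f N (p N ℕ.≤-refl)

#⇒≄ : ∀ {x y} → x # y → ¬ (x ≃ y)
#⇒≄ {x} {y} (mk# c c>0 far) x≃y = eventually-true
  (Eventually-∩ (λ n p q → ℚ.≤-<-trans p q) far (close x≃y c c>0))
  λ n c<c → ℚ.<-irrefl refl c<c

-- Compare z with x and with y at precision half the gap: being near to both would bring x and y
-- closer than the gap.
#-cotrans : ∀ {x y} → x # y → ∀ z → z # x ⊎ z # y
#-cotrans {x} {y} (mk# c c>0 far) z = decide (near-or-apart z x (½>0 c>0)) (near-or-apart z y (½>0 c>0))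
  where
  both : ∀ {p q r} → ℚ.∣ r ℚ.- p ∣ ℚ.< ½ ℚ.* c → ℚ.∣ r ℚ.- q ∣ ℚ.< ½ ℚ.* c → ℚ.∣ p ℚ.- q ∣ ℚ.< c
  both {p} {q} {r} r-p r-q = begin-strict
    ℚ.∣ p ℚ.- q ∣                          ≡⟨ cong ℚ.∣_∣ (solve 3 (λ p q r → p :- q := :- (r :- p) :+ (r :- q)) refl p q r) ⟩
    ℚ.∣ ℚ.- (r ℚ.- p) ℚ.+ (r ℚ.- q) ∣      ≤⟨ ℚ.∣p+q∣≤∣p∣+∣q∣ (ℚ.- (r ℚ.- p)) (r ℚ.- q) ⟩
    ℚ.∣ ℚ.- (r ℚ.- p) ∣ ℚ.+ ℚ.∣ r ℚ.- q ∣  ≡⟨ cong (ℚ._+ ℚ.∣ r ℚ.- q ∣) (ℚ.∣-p∣≡∣p∣ (r ℚ.- p)) ⟩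
    ℚ.∣ r ℚ.- p ∣ ℚ.+ ℚ.∣ r ℚ.- q ∣        <⟨ ℚ.+-mono-< r-p r-q ⟩
    ½ ℚ.* c ℚ.+ ½ ℚ.* c                    ≡⟨ halves c ⟩
    c                                      ∎
    where open ℚ.≤-Reasoning
  decide : z # x ⊎ Eventually (λ n → ℚ.∣ seq z n ℚ.- seq x n ∣ ℚ.< ½ ℚ.* c) →
           z # y ⊎ Eventually (λ n → ℚ.∣ seq z n ℚ.- seq y n ∣ ℚ.< ½ ℚ.* c) → z # x ⊎ z # y
  decide (inj₁ z#x) _          = inj₁ z#x
  decide (inj₂ _)   (inj₁ z#y) = inj₂ z#y
  decide (inj₂ p)   (inj₂ q)   = eventually-true
    (Eventually-∩ (λ n → ℚ.≤-<-trans) far (Eventually-∩ (λ n → both {seq x n} {seq y n} {seq z n}) p q))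
    λ n c<c → contradiction c<c (ℚ.<-irrefl refl)

module _ {A : Set} (f : A → ℝ) where

  apart-from-some : ∀ {x xs} → All (λ y → f x # f y) xs → ∀ z → z # f x ⊎ All (λ y → z # f y) xs
  apart-from-some         []         z = inj₂ []
  apart-from-some {x} {y ∷ ys} (p ∷ rest) z = combine (#-cotrans p z) (apart-from-some rest z)
    where
    combine : z # f x ⊎ z # f y → z # f x ⊎ All (λ y → z # f y) ys → z # f x ⊎ All (λ y → z # f y) (y ∷ ys)
    combine (inj₁ z#x) _          = inj₁ z#x
    combine (inj₂ _)   (inj₁ z#x) = inj₁ z#x
    combine (inj₂ z#y) (inj₂ all) = inj₂ (z#y ∷ all)

  -- A negated conjunction does not by itself single out an entry; the apartness of the entries
  -- does. By cotransitivity z is apart from the head, which is then discarded, or from the whole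
  -- tail, and then tightness makes it equal to the head.
  ¬all-apart⇒any-equal : ∀ {xs} → AllPairs (_#_ on f) xs → ∀ z → ¬ All (λ y → z # f y) xs →
                         Any (λ y → z ≃ f y) xs
  ¬all-apart⇒any-equal []         z ¬all = contradiction [] ¬all
  ¬all-apart⇒any-equal (p ∷ rest) z ¬all =
    [ (λ z#x → there (¬all-apart⇒any-equal rest z (¬all ∘ (z#x ∷_))))
    , (λ all → here (#-tight (¬all ∘ (_∷ all))))
    ]′ (apart-from-some p z)

-- Stands in for invertibility: cancellation is what the eigenvector arguments use, it is stable
-- under products, and it asks for no inverse in `ℝ`.
Regular : ℝ → Set
Regular x = ∀ {y} → x *ʳ y ≃ 0ℝ → y ≃ 0ℝ

regular-resp : ∀ {x y} → x ≃ y → Regular x → Regular y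
regular-resp x≃y reg yz≃0 = reg (≃-trans (*-congʳ x≃y) yz≃0)

regular-* : ∀ {x y} → Regular x → Regular y → Regular (x *ʳ y)
regular-* {x} {y} reg-x reg-y {z} xyz≃0 = reg-y (reg-x (≃-trans (≃-sym (*-assoc x y z)) xyz≃0))

#⇒regular : ∀ {x y} → x # y → Regular (x - y)
#⇒regular {x} {y} (mk# c c>0 far) {u} zu≃0 = mk≃ λ ε ε>0 →
  Eventually-∩ (λ n → bound (seq x n ℚ.- seq y n) (seq u n)) far
    (close zu≃0 (c ℚ.* ε) (ℚ.positive⁻¹ (c ℚ.* ε) {{ℚ.pos*pos⇒pos c ε {{ℚ.positive ε>0}}}}))
  where
  instance
    c-pos : ℚ.Positive c
    c-pos = ℚ.positive c>0
    c-nonNeg : ℚ.NonNegative c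
    c-nonNeg = ℚ.pos⇒nonNeg c
  bound : ∀ z v {ε} → c ℚ.≤ ℚ.∣ z ∣ → ℚ.∣ z ℚ.* v ℚ.- 0ℚ ∣ ℚ.< c ℚ.* ε → ℚ.∣ v ℚ.- 0ℚ ∣ ℚ.< ε
  bound z v {ε} c≤ lt = ℚ.*-cancelˡ-<-nonNeg c (begin-strict
    c ℚ.* ℚ.∣ v ℚ.- 0ℚ ∣     ≡⟨ cong (λ t → c ℚ.* ℚ.∣ t ∣) (ℚ.+-identityʳ v) ⟩
    c ℚ.* ℚ.∣ v ∣            ≤⟨ ℚ.*-monoʳ-≤-nonNeg ℚ.∣ v ∣ {{ℚ.∣-∣-nonNeg v}} c≤ ⟩
    ℚ.∣ z ∣ ℚ.* ℚ.∣ v ∣      ≡⟨ ℚ.∣p*q∣≡∣p∣*∣q∣ z v ⟨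
    ℚ.∣ z ℚ.* v ∣            ≡⟨ cong ℚ.∣_∣ (ℚ.+-identityʳ (z ℚ.* v)) ⟨
    ℚ.∣ z ℚ.* v ℚ.- 0ℚ ∣     <⟨ lt ⟩
    c ℚ.* ε                  ∎)
    where open ℚ.≤-Reasoning

-- If B bounds |w| and |x - y| were below 1/(2B), the product would be below 1/2 in absolute value,
-- contradicting its convergence to 1.
unit⇒# : ∀ {x y w} → (x - y) *ʳ w ≃ 1ℝ → x # y
unit⇒# {x} {y} {w} zw≃1 = go (bounded w)
  where
  go : (∃[ B ] 0ℚ ℚ.< B × Eventually λ n → ℚ.∣ seq w n ∣ ℚ.< B) → x # y
  go (B , B>0 , w<B) = [ (λ x#y → x#y) , close-to-1 ]′ (near-or-apart x y δ>0)
    where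
    instance
      B-pos : ℚ.Positive B
      B-pos = ℚ.positive B>0
      B-nonZero : ℚ.NonZero B
      B-nonZero = ℚ.pos⇒nonZero B
    δ : ℚ
    δ = ℚ.1/ B ℚ.* ½
    instance
      1/B-pos : ℚ.Positive (ℚ.1/ B)
      1/B-pos = ℚ.1/pos⇒pos B
      δ-pos : ℚ.Positive δ
      δ-pos = ℚ.pos*pos⇒pos (ℚ.1/ B) ½
      δ-nonNeg : ℚ.NonNegative δ
      δ-nonNeg = ℚ.pos⇒nonNeg δ
    δ>0 : 0ℚ ℚ.< δ
    δ>0 = ℚ.positive⁻¹ δ
    δB : δ ℚ.* B ≡ ½
    δB = begin
      ℚ.1/ B ℚ.* ½ ℚ.* B      ≡⟨ solve 3 (λ r h b → r :* h :* b := r :* b :* h) refl (ℚ.1/ B) ½ B ⟩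
      ℚ.1/ B ℚ.* B ℚ.* ½      ≡⟨ cong (ℚ._* ½) (ℚ.*-inverseˡ B) ⟩
      1ℚ ℚ.* ½                ≡⟨ ℚ.*-identityˡ ½ ⟩
      ½                       ∎
      where open ≡.≡-Reasoning
    small : ∀ z v → ℚ.∣ z ∣ ℚ.< δ → ℚ.∣ v ∣ ℚ.< B → ℚ.∣ z ℚ.* v ℚ.- 1ℚ ∣ ℚ.< ½ → 1ℚ ℚ.< 1ℚ
    small z v z< v< zv = begin-strict
      1ℚ                                           ≡⟨ cong ℚ.∣_∣ (solve 2 (λ t o → o := :- (t :- o) :+ t) refl (z ℚ.* v) 1ℚ) ⟩
      ℚ.∣ ℚ.- (z ℚ.* v ℚ.- 1ℚ) ℚ.+ z ℚ.* v ∣       ≤⟨ ℚ.∣p+q∣≤∣p∣+∣q∣ (ℚ.- (z ℚ.* v ℚ.- 1ℚ)) (z ℚ.* v) ⟩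
      ℚ.∣ ℚ.- (z ℚ.* v ℚ.- 1ℚ) ∣ ℚ.+ ℚ.∣ z ℚ.* v ∣ ≡⟨ cong₂ ℚ._+_ (ℚ.∣-p∣≡∣p∣ (z ℚ.* v ℚ.- 1ℚ)) (ℚ.∣p*q∣≡∣p∣*∣q∣ z v) ⟩
      ℚ.∣ z ℚ.* v ℚ.- 1ℚ ∣ ℚ.+ ℚ.∣ z ∣ ℚ.* ℚ.∣ v ∣ <⟨ ℚ.+-mono-<-≤ zv (ℚ.≤-trans
                                                        (ℚ.*-monoʳ-≤-nonNeg ℚ.∣ v ∣ {{ℚ.∣-∣-nonNeg v}} (ℚ.<⇒≤ z<))
                                                        (ℚ.*-monoˡ-≤-nonNeg δ (ℚ.<⇒≤ v<))) ⟩
      ½ ℚ.+ δ ℚ.* B                                ≡⟨ cong (½ ℚ.+_) δB ⟩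
      1ℚ                                           ∎
      where open ℚ.≤-Reasoning
    pair : {X Y : Set} → X → Y → X × Y
    pair x y = x , y
    close-to-1 : (Eventually λ n → ℚ.∣ seq x n ℚ.- seq y n ∣ ℚ.< δ) → x # y
    close-to-1 near = eventually-true
      (Eventually-∩ (λ n z< (w< , zw) → small (seq x n ℚ.- seq y n) (seq w n) z< w< zw)
        near (Eventually-∩ (λ _ → pair) w<B (close zw≃1 ½ (ℚ.positive⁻¹ ½))))
      λ n 1<1 → contradiction 1<1 (ℚ.<-irrefl refl)

-- The natural numbers in ℝ

private
  toℚᵘ-/1 : ∀ a → ℚ.toℚᵘ (+ a ℚ./ 1) ℚᵘ.≃ ℚᵘ.mkℚᵘ (+ a) 0
  toℚᵘ-/1 a = ℚ.toℚᵘ-fromℚᵘ (ℚᵘ.mkℚᵘ (+ a) 0)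

/1-+ : ∀ a b → + (a ℕ.+ b) ℚ./ 1 ≡ + a ℚ./ 1 ℚ.+ + b ℚ./ 1
/1-+ a b = ℚ.toℚᵘ-injective (begin-equality
  ℚ.toℚᵘ (+ (a ℕ.+ b) ℚ./ 1)                     ≃⟨ toℚᵘ-/1 (a ℕ.+ b) ⟩
  ℚᵘ.mkℚᵘ (+ (a ℕ.+ b)) 0                        ≡⟨ cong (λ c → ℚᵘ.mkℚᵘ c 0) (cong₂ ℤ._+_ (ℤ.*-identityʳ (+ a)) (ℤ.*-identityʳ (+ b))) ⟨
  ℚᵘ.mkℚᵘ (+ a) 0 ℚᵘ.+ ℚᵘ.mkℚᵘ (+ b) 0           ≃⟨ ℚᵘ.+-cong (toℚᵘ-/1 a) (toℚᵘ-/1 b) ⟨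
  ℚ.toℚᵘ (+ a ℚ./ 1) ℚᵘ.+ ℚ.toℚᵘ (+ b ℚ./ 1)     ≃⟨ ℚ.toℚᵘ-homo-+ (+ a ℚ./ 1) (+ b ℚ./ 1) ⟨
  ℚ.toℚᵘ (+ a ℚ./ 1 ℚ.+ + b ℚ./ 1)               ∎)
  where open ℚᵘ.≤-Reasoning

fromℕ-+ : ∀ a b → fromℕ (a ℕ.+ b) ≃ fromℕ a +ʳ fromℕ b
fromℕ-+ a b = pointwise λ _ → /1-+ a b

fromℕ-unit : ∀ a → .{{_ : ℕ.NonZero a}} → ∃[ r ] r *ʳ fromℕ a ≃ 1ℝ
fromℕ-unit a = fromℚ (ℚ.1/ (+ a ℚ./ 1)) , pointwise λ _ → ℚ.*-inverseˡ (+ a ℚ./ 1)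
  where
  instance
    a-nonZero : ℚ.NonZero (+ a ℚ./ 1)
    a-nonZero = ℚ.pos⇒nonZero (+ a ℚ./ 1) {{ℚ.normalize-pos a 1}}

unit⇒regular : ∀ {r x} → r *ʳ x ≃ 1ℝ → Regular x
unit⇒regular {r} {x} rx≃1 {y} xy≃0 = begin
  y                 ≈⟨ *-identityˡ y ⟨
  1ℝ *ʳ y           ≈⟨ *-congʳ rx≃1 ⟨
  (r *ʳ x) *ʳ y     ≈⟨ *-assoc r x y ⟩
  r *ʳ (x *ʳ y)     ≈⟨ *-congˡ xy≃0 ⟩
  r *ʳ 0ℝ           ≈⟨ zeroʳ r ⟩
  0ℝ                ∎
  where open ≃-Reasoning

private
  x≃x+y-y : ∀ x y → x ≃ (x +ʳ y) - y
  x≃x+y-y x y = pointwise λ m → solve 2 (λ x y → x := (x :+ y) :- y) refl (seq x m) (seq y m)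

-- Linear maps between spaces of real functions

infix  4 _≋_
infixl 6 _⊕_
infixr 7 _•_

_≋_ : ∀ {X : Set} → (X → ℝ) → (X → ℝ) → Set
f ≋ g = ∀ x → f x ≃ g x

_⊕_ : ∀ {X : Set} → (X → ℝ) → (X → ℝ) → X → ℝ
(f ⊕ g) x = f x +ʳ g x

_•_ : ∀ {X : Set} → ℝ → (X → ℝ) → X → ℝ
(c • f) x = c *ʳ f x

𝟎 : ∀ {X : Set} → X → ℝ
𝟎 _ = 0ℝ

record Linear {X Y : Set} (φ : (X → ℝ) → Y → ℝ) : Set where
  field
    resp   : ∀ {f g} → f ≋ g → φ f ≋ φ g
    +-homo : ∀ f g → φ (f ⊕ g) ≋ φ f ⊕ φ g
    •-homo : ∀ c f → φ (c • f) ≋ c • φ f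

  𝟎-homo : φ 𝟎 ≋ 𝟎
  𝟎-homo y = begin
    φ 𝟎 y              ≈⟨ resp (λ x → zeroˡ 0ℝ) y ⟨
    φ (0ℝ • 𝟎) y       ≈⟨ •-homo 0ℝ 𝟎 y ⟩
    0ℝ *ʳ φ 𝟎 y        ≈⟨ zeroˡ (φ 𝟎 y) ⟩
    0ℝ                 ∎
    where open ≃-Reasoning

  vanish : ∀ {f} → f ≋ 𝟎 → φ f ≋ 𝟎
  vanish f≋𝟎 y = ≃-trans (resp f≋𝟎 y) (𝟎-homo y)

-- Raising and lowering operators on the Boolean lattice

-- (D f)(S) is the sum of f over the upper covers of S, (U f)(S) over its lower covers.
D U : ∀ {n} → (Subset n → ℝ) → Subset n → ℝ
D f []            = 0ℝ
D f (outside ∷ S) = D (f ∘ (outside ∷_)) S +ʳ f (inside ∷ S)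
D f (inside  ∷ S) = D (f ∘ (inside ∷_)) S
U f []            = 0ℝ
U f (outside ∷ S) = U (f ∘ (outside ∷_)) S
U f (inside  ∷ S) = U (f ∘ (inside ∷_)) S +ʳ f (outside ∷ S)

D-linear : ∀ {n} → Linear (D {n})
D-linear = record { resp = λ {f} {g} → cg f g ; +-homo = add ; •-homo = mul }
  where
  cg : ∀ {n} (f g : Subset n → ℝ) → f ≋ g → D f ≋ D g
  cg f g eq []            = ≃-refl
  cg f g eq (outside ∷ S) = +ʳ-cong (cg _ _ (eq ∘ (outside ∷_)) S) (eq (inside ∷ S))
  cg f g eq (inside  ∷ S) = cg _ _ (eq ∘ (inside ∷_)) S
  add : ∀ {n} (f g : Subset n → ℝ) → D (f ⊕ g) ≋ D f ⊕ D g
  add f g []            = ≃-sym (+-identityʳ 0ℝ)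
  add f g (outside ∷ S) = ≃-trans (+-congʳ (add _ _ S)) (interchange _ _ _ _)
  add f g (inside  ∷ S) = add _ _ S
  mul : ∀ {n} c (f : Subset n → ℝ) → D (c • f) ≋ c • D f
  mul c f []            = ≃-sym (zeroʳ c)
  mul c f (outside ∷ S) = ≃-trans (+-congʳ (mul c _ S)) (≃-sym (distribˡ c _ _))
  mul c f (inside  ∷ S) = mul c _ S

U-linear : ∀ {n} → Linear (U {n})
U-linear = record { resp = λ {f} {g} → cg f g ; +-homo = add ; •-homo = mul }
  where
  cg : ∀ {n} (f g : Subset n → ℝ) → f ≋ g → U f ≋ U g
  cg f g eq []            = ≃-refl
  cg f g eq (outside ∷ S) = cg _ _ (eq ∘ (outside ∷_)) S
  cg f g eq (inside  ∷ S) = +ʳ-cong (cg _ _ (eq ∘ (inside ∷_)) S) (eq (outside ∷ S))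
  add : ∀ {n} (f g : Subset n → ℝ) → U (f ⊕ g) ≋ U f ⊕ U g
  add f g []            = ≃-sym (+-identityʳ 0ℝ)
  add f g (outside ∷ S) = add _ _ S
  add f g (inside  ∷ S) = ≃-trans (+-congʳ (add _ _ S)) (interchange _ _ _ _)
  mul : ∀ {n} c (f : Subset n → ℝ) → U (c • f) ≋ c • U f
  mul c f []            = ≃-sym (zeroʳ c)
  mul c f (outside ∷ S) = mul c _ S
  mul c f (inside  ∷ S) = ≃-trans (+-congʳ (mul c _ S)) (≃-sym (distribˡ c _ _))

module Dₗ {n : ℕ} = Linear (D-linear {n})
module Uₗ {n : ℕ} = Linear (U-linear {n})

private
  0+0 : ∀ {a b} → a ≃ 0ℝ → b ≃ 0ℝ → a +ʳ b ≃ 0ℝ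
  0+0 a≃0 b≃0 = ≃-trans (+ʳ-cong a≃0 b≃0) (+-identityʳ 0ℝ)

D-local : ∀ {n} (f : Subset n → ℝ) S → (∀ T → ∣ T ∣ ≡ suc ∣ S ∣ → f T ≃ 0ℝ) → D f S ≃ 0ℝ
D-local f []            f≃0 = ≃-refl
D-local f (outside ∷ S) f≃0 = 0+0 (D-local _ S (λ T → f≃0 (outside ∷ T))) (f≃0 (inside ∷ S) refl)
D-local f (inside  ∷ S) f≃0 = D-local _ S (λ T → f≃0 (inside ∷ T) ∘ cong suc)

U-local : ∀ {n} (f : Subset n → ℝ) S → (∀ T → suc ∣ T ∣ ≡ ∣ S ∣ → f T ≃ 0ℝ) → U f S ≃ 0ℝ
U-local f []            f≃0 = ≃-refl
U-local f (outside ∷ S) f≃0 = U-local _ S (λ T → f≃0 (outside ∷ T))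
U-local f (inside  ∷ S) f≃0 = 0+0 (U-local _ S (λ T → f≃0 (inside ∷ T) ∘ cong suc)) (f≃0 (outside ∷ S) refl)

-- Complementation reverses inclusion and so exchanges upper and lower covers.
D-∁ : ∀ {n} (f : Subset n → ℝ) S → D (f ∘ ∁) S ≃ U f (∁ S)
D-∁ f []            = ≃-refl
D-∁ f (outside ∷ S) = +-congʳ (D-∁ (f ∘ (inside ∷_)) S)
D-∁ f (inside  ∷ S) = D-∁ (f ∘ (outside ∷_)) S

-- [D , U] = n - 2 |S|, with the subtraction moved to the other side.
commutator : ∀ {n} (f : Subset n → ℝ) S →
             D (U f) S +ʳ fromℕ (∣ S ∣ ℕ.+ ∣ S ∣) *ʳ f S ≃ U (D f) S +ʳ fromℕ n *ʳ f S
commutator f [] = ≃-refl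
commutator {suc n} f (outside ∷ S) = begin
  -- The extra `x` comes from adding the first element and removing it again; it balances the growth
  -- of n by one while the size of the set is unchanged.
  (A +ʳ (B +ʳ x)) +ʳ s *ʳ x             ≈⟨ pointwise (λ m → solve 4 (λ a b x s →
                                             (a :+ (b :+ x)) :+ s :* x := (a :+ s :* x) :+ (b :+ x)) refl
                                             (seq A m) (seq B m) (seq x m) (seq s m)) ⟩
  (A +ʳ s *ʳ x) +ʳ (B +ʳ x)             ≈⟨ +-congʳ (commutator (f ∘ (outside ∷_)) S) ⟩
  (E +ʳ fromℕ n *ʳ x) +ʳ (B +ʳ x)       ≈⟨ pointwise (λ m → solve 4 (λ c b x n →
                                             (c :+ n :* x) :+ (b :+ x) := (c :+ b) :+ (con 1ℚ :+ n) :* x) refl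
                                             (seq E m) (seq B m) (seq x m) (seq (fromℕ n) m)) ⟩
  (E +ʳ B) +ʳ (1ℝ +ʳ fromℕ n) *ʳ x      ≈⟨ +ʳ-cong (≃-sym (Uₗ.+-homo _ _ S)) (*-congʳ (≃-sym (fromℕ-+ 1 n))) ⟩
  U (D f) (outside ∷ S) +ʳ fromℕ (suc n) *ʳ x ∎
  where
  open ≃-Reasoning
  A B E x s : ℝ
  A = D (U (f ∘ (outside ∷_))) S
  B = U (f ∘ (inside ∷_)) S
  E = U (D (f ∘ (outside ∷_))) S
  x = f (outside ∷ S)
  s = fromℕ (∣ S ∣ ℕ.+ ∣ S ∣)
commutator {suc n} f (inside ∷ S) = begin
  -- Now the first element is removed and put back, so the extra `x` sits in `U (D f)`. Together
  -- with the growth of n it balances the growth of twice the size by two.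
  D (U f) (inside ∷ S) +ʳ fromℕ (suc ∣ S ∣ ℕ.+ suc ∣ S ∣) *ʳ x  ≈⟨ +ʳ-cong (Dₗ.+-homo _ _ S) (*-congʳ s+2) ⟩
  (A +ʳ B) +ʳ (1ℝ +ʳ (1ℝ +ʳ s)) *ʳ x    ≈⟨ pointwise (λ m → solve 4 (λ a b x s →
                                             (a :+ b) :+ (con 1ℚ :+ (con 1ℚ :+ s)) :* x := (a :+ s :* x) :+ (b :+ x :+ x)) refl
                                             (seq A m) (seq B m) (seq x m) (seq s m)) ⟩
  (A +ʳ s *ʳ x) +ʳ (B +ʳ x +ʳ x)        ≈⟨ +-congʳ (commutator (f ∘ (inside ∷_)) S) ⟩
  (E +ʳ fromℕ n *ʳ x) +ʳ (B +ʳ x +ʳ x)  ≈⟨ pointwise (λ m → solve 4 (λ c b x n →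
                                             (c :+ n :* x) :+ (b :+ x :+ x) := (c :+ (b :+ x)) :+ (con 1ℚ :+ n) :* x) refl
                                             (seq E m) (seq B m) (seq x m) (seq (fromℕ n) m)) ⟩
  (E +ʳ (B +ʳ x)) +ʳ (1ℝ +ʳ fromℕ n) *ʳ x ≈⟨ +-congˡ (*-congʳ (≃-sym (fromℕ-+ 1 n))) ⟩
  U (D f) (inside ∷ S) +ʳ fromℕ (suc n) *ʳ x ∎
  where
  open ≃-Reasoning
  A B E x s : ℝ
  A = D (U (f ∘ (inside ∷_))) S
  B = D (f ∘ (outside ∷_)) S
  E = U (D (f ∘ (inside ∷_))) S
  x = f (inside ∷ S)
  s = fromℕ (∣ S ∣ ℕ.+ ∣ S ∣)
  s+2 : fromℕ (suc ∣ S ∣ ℕ.+ suc ∣ S ∣) ≃ 1ℝ +ʳ (1ℝ +ʳ s)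
  s+2 = begin
    fromℕ (suc ∣ S ∣ ℕ.+ suc ∣ S ∣)          ≡⟨ cong (fromℕ ∘ suc) (ℕ.+-suc ∣ S ∣ ∣ S ∣) ⟩
    fromℕ (2 ℕ.+ (∣ S ∣ ℕ.+ ∣ S ∣))          ≈⟨ fromℕ-+ 1 (suc (∣ S ∣ ℕ.+ ∣ S ∣)) ⟩
    1ℝ +ʳ fromℕ (1 ℕ.+ (∣ S ∣ ℕ.+ ∣ S ∣))    ≈⟨ +-congˡ (fromℕ-+ 1 (∣ S ∣ ℕ.+ ∣ S ∣)) ⟩
    1ℝ +ʳ (1ℝ +ʳ s)                          ∎

-- Functions supported on one level

Level : ∀ {n} → ℕ → (Subset n → ℝ) → Set
Level i f = ∀ S → ∣ S ∣ ≢ i → f S ≃ 0ℝ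

D-level : ∀ {n i} {f : Subset n → ℝ} → Level (suc i) f → Level i (D f)
D-level {f = f} lev S S≢ = D-local f S λ T T≡ → lev T λ T≡i → S≢ (ℕ.suc-injective (≡.trans (≡.sym T≡) T≡i))

D-level-0 : ∀ {n} {f : Subset n → ℝ} → Level 0 f → D f ≋ 𝟎
D-level-0 {f = f} lev S = D-local f S λ T T≡ → lev T λ T≡0 → contradiction (≡.trans (≡.sym T≡) T≡0) λ ()

U-level : ∀ {n i} {f : Subset n → ℝ} → Level i f → Level (suc i) (U f)
U-level {f = f} lev S S≢ = U-local f S λ T T≡ → lev T λ T≡i → S≢ (≡.trans (≡.sym T≡) (cong suc T≡i))

-- A natural `d` for n - 2i confines the statement to the lower half. Since `f` lives on all
-- subsets, the identity must also hold off level i; there both scalar terms vanish with `f`.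
commutator-level : ∀ {n i d} {f : Subset n → ℝ} → n ≡ i ℕ.+ i ℕ.+ d → Level i f →
                   D (U f) ≋ U (D f) ⊕ fromℕ d • f
commutator-level {n} {i} {d} {f} n≡ lev S = begin
  A                                      ≈⟨ x≃x+y-y A (s *ʳ x) ⟩
  (A +ʳ s *ʳ x) - s *ʳ x                 ≈⟨ +-congʳ (commutator f S) ⟩
  (E +ʳ fromℕ n *ʳ x) - s *ʳ x           ≈⟨ +-assoc E _ _ ⟩
  E +ʳ (fromℕ n *ʳ x - s *ʳ x)           ≈⟨ +-congˡ (difference (∣ S ∣ ℕ.≟ i)) ⟩
  E +ʳ fromℕ d *ʳ x                      ∎
  where
  open ≃-Reasoning
  A E x s : ℝ
  A = D (U f) S
  E = U (D f) S
  x = f S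
  s = fromℕ (∣ S ∣ ℕ.+ ∣ S ∣)
  difference : _ → fromℕ n *ʳ x - s *ʳ x ≃ fromℕ d *ʳ x
  difference (yes refl) = begin
    fromℕ n *ʳ x - s *ʳ x                     ≡⟨ cong (λ k → fromℕ k *ʳ x - s *ʳ x) n≡ ⟩
    fromℕ (i ℕ.+ i ℕ.+ d) *ʳ x - s *ʳ x       ≈⟨ +-congʳ (*-congʳ (fromℕ-+ (i ℕ.+ i) d)) ⟩
    (s +ʳ fromℕ d) *ʳ x - s *ʳ x              ≈⟨ pointwise (λ m → solve 3 (λ s d x → (s :+ d) :* x :- s :* x := d :* x) refl
                                                   (seq s m) (seq (fromℕ d) m) (seq x m)) ⟩
    fromℕ d *ʳ x                              ∎
  difference (no S≢i) = begin
    fromℕ n *ʳ x - s *ʳ x      ≈⟨ +ʳ-cong (x≃0 (fromℕ n)) (-ʳ-cong (x≃0 s)) ⟩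
    0ℝ - 0ℝ                    ≈⟨ -‿inverseʳ 0ℝ ⟩
    0ℝ                         ≈⟨ x≃0 (fromℕ d) ⟨
    fromℕ d *ʳ x               ∎
    where
    x≃0 : ∀ c → c *ʳ x ≃ 0ℝ
    x≃0 c = ≃-trans (*-congˡ (lev S S≢i)) (zeroʳ c)

U-D-eigenvector : ∀ {n i d ν} {f : Subset n → ℝ} → n ≡ i ℕ.+ i ℕ.+ d → Level i f →
                  D (U f) ≋ ν • f → U (D f) ≋ (ν - fromℕ d) • f
U-D-eigenvector {d = d} {ν} {f} n≡ lev eig S = begin
  U (D f) S                                   ≈⟨ x≃x+y-y (U (D f) S) (fromℕ d *ʳ x) ⟩
  (U (D f) S +ʳ fromℕ d *ʳ x) - fromℕ d *ʳ x  ≈⟨ +-congʳ (commutator-level n≡ lev S) ⟨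
  D (U f) S - fromℕ d *ʳ x                    ≈⟨ +-congʳ (eig S) ⟩
  ν *ʳ x - fromℕ d *ʳ x                       ≈⟨ pointwise (λ m → solve 3 (λ v d x → v :* x :- d :* x := (v :- d) :* x) refl
                                                  (seq ν m) (seq (fromℕ d) m) (seq x m)) ⟩
  (ν - fromℕ d) *ʳ x                          ∎
  where
  open ≃-Reasoning
  x : ℝ
  x = f S

private
  levels : ∀ i d → suc i ℕ.+ suc i ℕ.+ d ≡ i ℕ.+ i ℕ.+ (2 ℕ.+ d)
  levels = solve-∀

-- D f is again an eigenvector of D U, for the eigenvalue ν - d, so that the
-- eigenvalues on level i are d, d + (d + 2), d + (d + 2) + (d + 4), ...
regular⇒no-eigenvector : ∀ i {n d ν} {f : Subset n → ℝ} → n ≡ i ℕ.+ i ℕ.+ d → Level i f →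
                         D (U f) ≋ ν • f →
                         (∀ t j → t ℕ.+ j ≡ i → Regular (ν - fromℕ (suc t ℕ.* (t ℕ.+ d)))) → f ≋ 𝟎
regular⇒no-eigenvector i {n} {d} {ν} {f} n≡ lev eig reg S = regular (begin
  (ν - fromℕ d) *ʳ f S                            ≈⟨ shifted S ⟨
  U (D f) S                                       ≈⟨ Uₗ.vanish (lowered i n≡ lev reg) S ⟩
  0ℝ                                              ∎)
  where
  open ≃-Reasoning
  regular : Regular (ν - fromℕ d)
  regular = subst (λ e → Regular (ν - fromℕ e)) (ℕ.*-identityˡ d) (reg 0 i refl)
  shifted : U (D f) ≋ (ν - fromℕ d) • f
  shifted = U-D-eigenvector n≡ lev eig
  lowered : ∀ i → n ≡ i ℕ.+ i ℕ.+ d → Level i f →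
            (∀ t j → t ℕ.+ j ≡ i → Regular (ν - fromℕ (suc t ℕ.* (t ℕ.+ d)))) → D f ≋ 𝟎
  lowered zero    _  lev _   = D-level-0 lev
  -- One level lower the parameter d becomes d + 2. As (t + 2)(t + 1 + d) = d + (t + 1)(t + d + 2),
  -- the excluded values for ν, shifted by d, are the excluded values for ν - d.
  lowered (suc i) n≡ lev reg = regular⇒no-eigenvector i (≡.trans n≡ (levels i d)) (D-level lev)
    (λ S → ≃-trans (Dₗ.resp shifted S) (Dₗ.•-homo (ν - fromℕ d) f S))
    λ t j t+j≡i → regular-resp (step t) (reg (suc t) j (cong suc t+j≡i))
    where
    eigenvalue : ∀ t d → suc (suc t) ℕ.* (suc t ℕ.+ d) ≡ d ℕ.+ suc t ℕ.* (t ℕ.+ (2 ℕ.+ d))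
    eigenvalue = solve-∀
    step : ∀ t → ν - fromℕ (suc (suc t) ℕ.* (suc t ℕ.+ d)) ≃ (ν - fromℕ d) - fromℕ (suc t ℕ.* (t ℕ.+ (2 ℕ.+ d)))
    step t = begin
      ν - fromℕ (suc (suc t) ℕ.* (suc t ℕ.+ d))   ≡⟨ cong (λ e → ν - fromℕ e) (eigenvalue t d) ⟩
      ν - fromℕ (d ℕ.+ e)                         ≈⟨ +-congˡ (-ʳ-cong (fromℕ-+ d e)) ⟩
      ν - (fromℕ d +ʳ fromℕ e)                    ≈⟨ pointwise (λ m → solve 3 (λ v d e → v :- (d :+ e) := (v :- d) :- e) refl
                                                      (seq ν m) (seq (fromℕ d) m) (seq (fromℕ e) m)) ⟩
      (ν - fromℕ d) - fromℕ e                     ∎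
      where
      e = suc t ℕ.* (t ℕ.+ (2 ℕ.+ d))

-- A function killed by `U` is an eigenvector of D U for 0, while strictly below the middle the
-- possible eigenvalues (t + 1)(t + d + 1) are all positive.
U-injective : ∀ {n i d} {f : Subset n → ℝ} → n ≡ i ℕ.+ i ℕ.+ suc d → Level i f → U f ≋ 𝟎 → f ≋ 𝟎
U-injective {i = i} {d} {f} n≡ lev Uf≋𝟎 = regular⇒no-eigenvector i n≡ lev
  (λ S → ≃-trans (Dₗ.vanish Uf≋𝟎 S) (≃-sym (zeroˡ (f S))))
  λ t _ _ → subst (λ e → Regular (0ℝ - fromℕ (suc t ℕ.* e))) (≡.sym (ℕ.+-suc t d))
    (negated (suc t ℕ.* suc (t ℕ.+ d)))
  where
  negated : ∀ a → .{{_ : ℕ.NonZero a}} → Regular (0ℝ - fromℕ a)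
  negated a with fromℕ-unit a
  ... | r , ra≃1 = unit⇒regular { -ʳ r} (≃-trans
    (pointwise λ m → solve 2 (λ r a → (:- r) :* (con 0ℚ :- a) := r :* a) refl (seq r m) (seq (fromℕ a) m)) ra≃1)

-- Complementation and the two middle levels

∁-level : ∀ {n i} {f : Subset n → ℝ} → Level (suc i) f → n ≡ i ℕ.+ suc i → Level i (f ∘ ∁)
∁-level {n} {i} lev n≡ S S≢i = lev (∁ S) λ ∁S≡ → S≢i (ℕ.+-cancelʳ-≡ (suc i) ∣ S ∣ i (begin
  ∣ S ∣ ℕ.+ suc i          ≡⟨ cong (∣ S ∣ ℕ.+_) ∁S≡ ⟨
  ∣ S ∣ ℕ.+ ∣ ∁ S ∣        ≡⟨ cong (∣ S ∣ ℕ.+_) (∣∁p∣≡n∸∣p∣ S) ⟩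
  ∣ S ∣ ℕ.+ (n ℕ.∸ ∣ S ∣)  ≡⟨ ℕ.m+[n∸m]≡n (∣p∣≤n S) ⟩
  n                        ≡⟨ n≡ ⟩
  i ℕ.+ suc i              ∎))
  where open ≡.≡-Reasoning

∁-involutive : ∀ {n} (S : Subset n) → ∁ (∁ S) ≡ S
∁-involutive []            = refl
∁-involutive (outside ∷ S) = cong (outside ∷_) (∁-involutive S)
∁-involutive (inside  ∷ S) = cong (inside ∷_) (∁-involutive S)

-- For n = 2i + 1 complementation swaps levels i and i + 1, so that `D` from level i + 1 is
-- conjugate to `U` from level i, which is still strictly below the middle.
D-injective-middle : ∀ {n i} {f : Subset n → ℝ} → n ≡ i ℕ.+ suc i → Level (suc i) f → D f ≋ 𝟎 → f ≋ 𝟎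
D-injective-middle {n} {i} {f} n≡ lev Df≋𝟎 S = subst (λ T → f T ≃ 0ℝ) (∁-involutive S)
  (U-injective {d = 0} (≡.trans n≡ (≡.trans (ℕ.+-suc i i) (ℕ.+-comm 1 (i ℕ.+ i)))) (∁-level lev n≡) Uf∁≋𝟎 (∁ S))
  where
  Uf∁≋𝟎 : U (f ∘ ∁) ≋ 𝟎
  Uf∁≋𝟎 T = begin
    U (f ∘ ∁) T              ≡⟨ cong (U (f ∘ ∁)) (∁-involutive T) ⟨
    U (f ∘ ∁) (∁ (∁ T))      ≈⟨ D-∁ (f ∘ ∁) (∁ T) ⟨
    D (f ∘ ∁ ∘ ∁) (∁ T)      ≈⟨ Dₗ.resp (λ R → subst (λ R′ → f R′ ≃ f R) (≡.sym (∁-involutive R)) ≃-refl) (∁ T) ⟩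
    D f (∁ T)                ≈⟨ Df≋𝟎 (∁ T) ⟩
    0ℝ                       ∎
    where open ≃-Reasoning

-- Bases under linear maps

record IsSubspace {X : Set} (S : (X → ℝ) → Set) : Set where
  field
    resp     : ∀ {f g} → f ≋ g → S f → S g
    𝟎-closed : S 𝟎
    ⊕-closed : ∀ {f g} → S f → S g → S (f ⊕ g)
    •-closed : ∀ c {f} → S f → S (c • f)

linear-combination : ∀ {X : Set} {m} → (Fin m → ℝ) → (Fin m → X → ℝ) → X → ℝ
linear-combination c b x = ∑ λ i → c i *ʳ b i x

combination-closed : ∀ {X m} {S : (X → ℝ) → Set} → IsSubspace S → ∀ c (b : Fin m → X → ℝ) →
                     (∀ i → S (b i)) → S (linear-combination c b)
combination-closed {m = zero}  sub c b b∈ = IsSubspace.𝟎-closed sub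
combination-closed {m = suc m} sub c b b∈ =
  IsSubspace.⊕-closed sub (IsSubspace.•-closed sub (c zero) (b∈ zero))
    (combination-closed sub (c ∘ suc) (b ∘ suc) (b∈ ∘ suc))

combination-homo : ∀ {X Y m} {φ : (X → ℝ) → Y → ℝ} → Linear φ → ∀ c (b : Fin m → X → ℝ) →
                   φ (linear-combination c b) ≋ linear-combination c (φ ∘ b)
combination-homo {m = zero}  lin c b = Linear.𝟎-homo lin
combination-homo {m = suc m} {φ} lin c b y = ≃-trans
  (Linear.+-homo lin (c zero • b zero) (linear-combination (c ∘ suc) (b ∘ suc)) y)
  (+ʳ-cong (Linear.•-homo lin (c zero) (b zero) y) (combination-homo lin (c ∘ suc) (b ∘ suc) y))

∑-+ : ∀ m n (f : Fin (m ℕ.+ n) → ℝ) → ∑ f ≃ ∑ (f ∘ (_↑ˡ n)) +ʳ ∑ (f ∘ (m ↑ʳ_))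
∑-+ zero    n f = ≃-sym (+-identityˡ (∑ f))
∑-+ (suc m) n f = ≃-trans (+-congˡ (∑-+ m n (f ∘ suc))) (≃-sym (+-assoc _ _ _))

combination-++ : ∀ {X : Set} {m n} c (a : Fin m → X → ℝ) (b : Fin n → X → ℝ) →
                 linear-combination c (a Vector.++ b) ≋
                 linear-combination (c ∘ (_↑ˡ n)) a ⊕ linear-combination (c ∘ (m ↑ʳ_)) b
combination-++ {m = m} {n} c a b x = ≃-trans (∑-+ m n (λ i → c i *ʳ (a Vector.++ b) i x))
  (+ʳ-cong (sum-cong-≋ λ i → *-congˡ (≡⇒≃ (λ v → v x) (lookup-++ˡ a b i)))
           (sum-cong-≋ λ i → *-congˡ (≡⇒≃ (λ v → v x) (lookup-++ʳ a b i))))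
  where
  ≡⇒≃ : ∀ {A : Set} (f : A → ℝ) {u v} → u ≡ v → f u ≃ f v
  ≡⇒≃ f refl = ≃-refl

++-elim : ∀ {m n} (P : Fin (m ℕ.+ n) → Set) → (∀ i → P (i ↑ˡ n)) → (∀ i → P (m ↑ʳ i)) → ∀ i → P i
++-elim {m} {n} P left right i = subst P (join-splitAt m n i) (cases (splitAt m i))
  where
  cases : ∀ s → P (join m n s)
  cases (inj₁ i) = left i
  cases (inj₂ i) = right i

-- Injectivity is available only on `S`; `IsSubspace` is what places linear combinations of the
-- basis vectors in `S`. The graphs serve as carriers of index types: `BL n` stands for the
-- functions on all subsets.
dimension-≅ : ∀ (G H : Graph)
              {S : Spectrum.Vector G → Set} {T : Spectrum.Vector H → Set} {φ : Spectrum.Vector G → Spectrum.Vector H} {m} →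
              IsSubspace S → Linear φ →
              (∀ {v} → S v → T (φ v)) →
              (∀ {v} → S v → φ v ≋ 𝟎 → v ≋ 𝟎) →
              (∀ {w} → T w → ∃[ v ] S v × w ≋ φ v) →
              Spectrum.HasDimension G S m → Spectrum.HasDimension H T m
dimension-≅ G H {φ = φ} sub lin into inj onto (b , basis) = φ ∘ b , record
  { members     = λ i → into (members i)
  ; independent = λ c φ≋𝟎 → independent c (inj (combination-closed sub c b members)
      λ y → ≃-trans (combination-homo lin c b y) (φ≋𝟎 y))
  ; spanning    = λ w w∈T →
      let (v , v∈S , w≋φv) = onto w∈T
          (c , v≋cb) = spanning v v∈S
      in c , λ y → ≃-trans (w≋φv y) (≃-trans (Linear.resp lin v≋cb y) (combination-homo lin c b y))
  }
  where open Spectrum.IsBasis basis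

-- The two images need to form a direct sum, hence the joint injectivity in place of one condition
-- for each map.
dimension-⊕ : ∀ (G₁ G₂ H : Graph)
              {S₁ : Spectrum.Vector G₁ → Set} {S₂ : Spectrum.Vector G₂ → Set} {T : Spectrum.Vector H → Set}
              {φ : Spectrum.Vector G₁ → Spectrum.Vector H} {ψ : Spectrum.Vector G₂ → Spectrum.Vector H} {m₁ m₂} →
              IsSubspace S₁ → IsSubspace S₂ → Linear φ → Linear ψ →
              (∀ {v} → S₁ v → T (φ v)) → (∀ {v} → S₂ v → T (ψ v)) →
              (∀ {v w} → S₁ v → S₂ w → φ v ⊕ ψ w ≋ 𝟎 → v ≋ 𝟎 × w ≋ 𝟎) →
              (∀ {u} → T u → ∃[ v ] ∃[ w ] S₁ v × S₂ w × u ≋ φ v ⊕ ψ w) →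
              Spectrum.HasDimension G₁ S₁ m₁ → Spectrum.HasDimension G₂ S₂ m₂ → Spectrum.HasDimension H T (m₁ ℕ.+ m₂)
dimension-⊕ G₁ G₂ H {T = T} {φ} {ψ} {m₁} {m₂} sub₁ sub₂ lin-φ lin-ψ into₁ into₂ inj onto (a , basis₁) (b , basis₂) = ab , record
  { members     = ++-elim (T ∘ ab)
      (λ i → subst T (≡.sym (lookup-++ˡ (φ ∘ a) (ψ ∘ b) i)) (into₁ (B₁.members i)))
      (λ i → subst T (≡.sym (lookup-++ʳ (φ ∘ a) (ψ ∘ b) i)) (into₂ (B₂.members i)))
  ; independent = λ c ≋𝟎 →
      let (v≋𝟎 , w≋𝟎) = inj
            (combination-closed sub₁ (c ∘ (_↑ˡ m₂)) a B₁.members)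
            (combination-closed sub₂ (c ∘ (m₁ ↑ʳ_)) b B₂.members)
            (λ y → ≃-trans (≃-sym (expand c y)) (≋𝟎 y))
      in ++-elim (λ i → c i ≃ 0ℝ) (B₁.independent (c ∘ (_↑ˡ m₂)) v≋𝟎) (B₂.independent (c ∘ (m₁ ↑ʳ_)) w≋𝟎)
  ; spanning    = λ u u∈T →
      let (v , w , v∈S₁ , w∈S₂ , u≋) = onto u∈T
          (c , v≋) = B₁.spanning v v∈S₁
          (d , w≋) = B₂.spanning w w∈S₂
      in c Vector.++ d , λ y → ≃-trans (u≋ y) (≃-trans
           (+ʳ-cong (Linear.resp lin-φ (λ x → ≃-trans (v≋ x) (coefficients a (≡.sym ∘ lookup-++ˡ c d) x)) y)
                    (Linear.resp lin-ψ (λ x → ≃-trans (w≋ x) (coefficients b (≡.sym ∘ lookup-++ʳ c d) x)) y))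
           (≃-sym (expand (c Vector.++ d) y)))
  }
  where
  module B₁ = Spectrum.IsBasis basis₁
  module B₂ = Spectrum.IsBasis basis₂
  ab : Fin (m₁ ℕ.+ m₂) → Spectrum.Vector H
  ab = (φ ∘ a) Vector.++ (ψ ∘ b)
  expand : ∀ c → linear-combination c ab ≋
           φ (linear-combination (c ∘ (_↑ˡ m₂)) a) ⊕ ψ (linear-combination (c ∘ (m₁ ↑ʳ_)) b)
  expand c y = ≃-trans (combination-++ c (φ ∘ a) (ψ ∘ b) y)
    (≃-sym (+ʳ-cong (combination-homo lin-φ (c ∘ (_↑ˡ m₂)) a y) (combination-homo lin-ψ (c ∘ (m₁ ↑ʳ_)) b y)))
  coefficients : ∀ {X : Set} {m} {c d : Fin m → ℝ} (b : Fin m → X → ℝ) → (∀ i → c i ≡ d i) →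
                 linear-combination c b ≋ linear-combination d b
  coefficients b c≡d x = sum-cong-≋ λ i → *-congʳ (subst (_ ≃_) (c≡d i) ≃-refl)

-- Binomial coefficients in the lower half of a row

nC0≡1 : ∀ n → n C 0 ≡ 1
nC0≡1 n = ≡.trans (nCk≡nC[n∸k] (z≤n {n})) (nCn≡1 n)

middle : ∀ j → suc (j ℕ.+ j) C suc j ≡ suc (j ℕ.+ j) C j
middle j = ≡.trans (nCk≡nC[n∸k] (s≤s (ℕ.m≤m+n j j))) (cong (suc (j ℕ.+ j) C_) (ℕ.m+n∸m≡n j j))

-- Pascal's rule reduces the comparison to the previous row as long as both columns stay in its
-- lower half. In the extreme case the two columns are the central ones of an odd row, equal by
-- symmetry.
C-increasing : ∀ n j → suc j ℕ.+ suc j ℕ.≤ suc n → n C j ℕ.≤ n C suc j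
C-increasing zero    zero    (s≤s ())
C-increasing zero    (suc j) (s≤s ())
C-increasing (suc n) j le with ℕ.m≤n⇒m<n∨m≡n le
... | inj₂ eq = subst (λ m → m C j ℕ.≤ m C suc j)
                  (ℕ.suc-injective (≡.trans (cong suc (≡.sym (ℕ.+-suc j j))) eq)) (ℕ.≤-reflexive (≡.sym (middle j)))
C-increasing (suc n) zero    le | inj₁ _        = ≡.subst₂ ℕ._≤_ (≡.trans (nC0≡1 n) (≡.sym (nC0≡1 (suc n))))
  (nCk+nC[k+1]≡[n+1]C[k+1] n 0) (ℕ.m≤m+n (n C 0) (n C 1))
C-increasing (suc n) (suc j) le | inj₁ (s≤s le′) = ≡.subst₂ ℕ._≤_
  (nCk+nC[k+1]≡[n+1]C[k+1] n j) (nCk+nC[k+1]≡[n+1]C[k+1] n (suc j))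
  (ℕ.+-mono-≤ (C-increasing n j (ℕ.≤-trans (ℕ.+-mono-≤ (ℕ.n≤1+n (suc j)) (ℕ.n≤1+n (suc j))) le′)) (C-increasing n (suc j) le′))

binomial-difference-middle : ∀ j → binomial-difference (suc (j ℕ.+ j)) (suc j) ≡ 0
binomial-difference-middle j = ℕ.m≤n⇒m∸n≡0 (ℕ.≤-reflexive (middle j))

-- Pascal's rule in both terms. Monotonicity in the lower half makes the truncated subtractions
-- exact; the first column is separate because of the convention C(n, -1) = 0.
binomial-difference-suc : ∀ n j → suc j ℕ.+ suc j ℕ.≤ suc n →
  binomial-difference (suc n) (suc j) ≡ binomial-difference n (suc j) ℕ.+ binomial-difference n j
binomial-difference-suc n zero le = begin
  suc n C 1 ∸ suc n C 0                   ≡⟨ cong₂ _∸_ (≡.sym (nCk+nC[k+1]≡[n+1]C[k+1] n 0)) (≡.trans (nC0≡1 (suc n)) (≡.sym (nC0≡1 n))) ⟩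
  (n C 0 ℕ.+ n C 1) ∸ n C 0               ≡⟨ ℕ.m+n∸m≡n (n C 0) (n C 1) ⟩
  n C 1                                   ≡⟨ ℕ.m∸n+n≡m (C-increasing n 0 le) ⟨
  (n C 1 ∸ n C 0) ℕ.+ n C 0               ∎
  where open ≡.≡-Reasoning
binomial-difference-suc n (suc j) le = begin
  suc n C suc (suc j) ∸ suc n C suc j     ≡⟨ cong₂ _∸_ (nCk+nC[k+1]≡[n+1]C[k+1] n (suc j)) (nCk+nC[k+1]≡[n+1]C[k+1] n j) ⟨
  (b ℕ.+ c) ∸ (a ℕ.+ b)                   ≡⟨ cong (_∸ (a ℕ.+ b)) (ℕ.+-comm b c) ⟩
  (c ℕ.+ b) ∸ (a ℕ.+ b)                   ≡⟨ cong (_∸ (a ℕ.+ b)) (cong₂ ℕ._+_ (ℕ.m∸n+n≡m b≤c) (ℕ.m∸n+n≡m a≤b)) ⟨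
  ((c ∸ b ℕ.+ b) ℕ.+ (b ∸ a ℕ.+ a)) ∸ (a ℕ.+ b)   ≡⟨ cong (_∸ (a ℕ.+ b)) (rearrange (c ∸ b) b (b ∸ a) a) ⟩
  ((c ∸ b) ℕ.+ (b ∸ a) ℕ.+ (a ℕ.+ b)) ∸ (a ℕ.+ b) ≡⟨ ℕ.m+n∸n≡m _ (a ℕ.+ b) ⟩
  (c ∸ b) ℕ.+ (b ∸ a)                     ∎
  where
  open ≡.≡-Reasoning
  a b c : ℕ
  a = n C j
  b = n C suc j
  c = n C suc (suc j)
  b≤c : b ℕ.≤ c
  b≤c = C-increasing n (suc j) le
  a≤b : a ℕ.≤ b
  a≤b = C-increasing n j (ℕ.≤-trans (ℕ.+-mono-≤ (ℕ.n≤1+n (suc j)) (ℕ.n≤1+n (suc j))) le)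
  rearrange : ∀ p b q a → (p ℕ.+ b) ℕ.+ (q ℕ.+ a) ≡ p ℕ.+ q ℕ.+ (a ℕ.+ b)
  rearrange = solve-∀

-- Harmonic functions

below-middle : ∀ {n i d} → n ≡ i ℕ.+ i ℕ.+ suc d → suc i ℕ.+ suc i ℕ.≤ suc n
below-middle {n} {i} {d} n≡ = s≤s (≡.subst₂ ℕ._≤_ (≡.sym (ℕ.+-suc i i)) (≡.sym (≡.trans n≡ (ℕ.+-suc (i ℕ.+ i) d)))
  (s≤s (ℕ.m≤m+n (i ℕ.+ i) d)))

glue : ∀ {n} → (Subset n → ℝ) → (Subset n → ℝ) → Subset (suc n) → ℝ
glue f g (outside ∷ S) = f S
glue f g (inside  ∷ S) = g S

Harmonic : ∀ {n} → ℕ → (Subset n → ℝ) → Set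
Harmonic j f = Level j f × D f ≋ 𝟎

level-subspace : ∀ {n} i → IsSubspace (Level {n} i)
level-subspace i = record
  { resp     = λ f≋g lev S S≢i → ≃-trans (≃-sym (f≋g S)) (lev S S≢i)
  ; 𝟎-closed = λ _ _ → ≃-refl
  ; ⊕-closed = λ p q S S≢i → ≃-trans (+ʳ-cong (p S S≢i) (q S S≢i)) (+-identityʳ 0ℝ)
  ; •-closed = λ c p S S≢i → ≃-trans (*-congˡ (p S S≢i)) (zeroʳ c)
  }

module _ {n i : ℕ} where
  open IsSubspace (level-subspace {n} i) public using () renaming
    (resp to level-resp; ⊕-closed to level-⊕; •-closed to level-•)

harmonic-subspace : ∀ {n} j → IsSubspace (Harmonic {n} j)
harmonic-subspace j = record
  { resp     = λ f≋g (lev , Df≋𝟎) → level-resp f≋g lev , λ S → ≃-trans (Dₗ.resp (λ T → ≃-sym (f≋g T)) S) (Df≋𝟎 S)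
  ; 𝟎-closed = (λ _ _ → ≃-refl) , Dₗ.𝟎-homo
  ; ⊕-closed = λ {f} {g} (p , Df≋𝟎) (q , Dg≋𝟎) → level-⊕ p q , λ S →
      ≃-trans (Dₗ.+-homo f g S) (≃-trans (+ʳ-cong (Df≋𝟎 S) (Dg≋𝟎 S)) (+-identityʳ 0ℝ))
  ; •-closed = λ c {f} (p , Df≋𝟎) → level-• c p , λ S →
      ≃-trans (Dₗ.•-homo c f S) (≃-trans (*-congˡ (Df≋𝟎 S)) (zeroʳ c))
  }

D-U-harmonic : ∀ {n j d} {f : Subset n → ℝ} → n ≡ j ℕ.+ j ℕ.+ d → Harmonic j f → D (U f) ≋ fromℕ d • f
D-U-harmonic n≡ (lev , Df≋𝟎) S = ≃-trans (commutator-level n≡ lev S)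
  (≃-trans (+-congʳ (Uₗ.vanish Df≋𝟎 S)) (+-identityˡ _))

∣S∣≡0⇒S≡⊥ : ∀ {n} (S : Subset n) → ∣ S ∣ ≡ 0 → S ≡ ⊥
∣S∣≡0⇒S≡⊥ []            _  = refl
∣S∣≡0⇒S≡⊥ (outside ∷ S) eq = cong (outside ∷_) (∣S∣≡0⇒S≡⊥ S eq)

harmonic-dimension-0 : ∀ n → Spectrum.HasDimension (BL n) (Harmonic 0) 1
harmonic-dimension-0 n = (λ _ → δ) , record
  { members     = λ _ → lev , D-level-0 lev
  ; independent = λ { c c•δ≋𝟎 zero → begin
      c zero                          ≈⟨ *-identityʳ (c zero) ⟨
      c zero *ʳ 1ℝ                    ≈⟨ +-identityʳ _ ⟨
      c zero *ʳ 1ℝ +ʳ 0ℝ              ≡⟨ cong (λ t → c zero *ʳ t +ʳ 0ℝ) (cong at-0 (∣⊥∣≡0 n)) ⟨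
      c zero *ʳ δ ⊥ +ʳ 0ℝ             ≈⟨ c•δ≋𝟎 ⊥ ⟩
      0ℝ                              ∎ }
  ; spanning    = λ f (f-lev , _) → (λ _ → f ⊥) , λ S → ≃-trans (expand f f-lev S) (≃-sym (+-identityʳ _))
  }
  where
  open ≃-Reasoning
  at-0 : ℕ → ℝ
  at-0 zero    = 1ℝ
  at-0 (suc _) = 0ℝ
  δ : Subset n → ℝ
  δ S = at-0 ∣ S ∣
  at-≢0 : ∀ {m} → m ≢ 0 → at-0 m ≃ 0ℝ
  at-≢0 {zero}  m≢0 = contradiction refl m≢0
  at-≢0 {suc _} m≢0 = ≃-refl
  lev : Level 0 δ
  lev S = at-≢0
  expand : ∀ f → Level 0 f → ∀ S → f S ≃ f ⊥ *ʳ δ S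
  expand f f-lev S with ∣ S ∣ in eq
  ... | zero  = ≃-trans (subst (λ T → f S ≃ f T) (∣S∣≡0⇒S≡⊥ S eq) ≃-refl) (≃-sym (*-identityʳ (f ⊥)))
  ... | suc _ = ≃-trans (f-lev S λ S≡0 → contradiction (≡.trans (≡.sym eq) S≡0) λ ()) (≃-sym (zeroʳ (f ⊥)))

-- Splitting off the first element, f = (g | h) is harmonic iff D g = - h and
-- D h = 0; since D (U h) = d h, such pairs are (g₀ - U h / d | h) with g₀ and h harmonic.
harmonic-dimension-suc : ∀ {n j d p q} → n ≡ j ℕ.+ j ℕ.+ suc d →
  Spectrum.HasDimension (BL n) (Harmonic (suc j)) p → Spectrum.HasDimension (BL n) (Harmonic j) q →
  Spectrum.HasDimension (BL (suc n)) (Harmonic (suc j)) (p ℕ.+ q)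
harmonic-dimension-suc {n} {j} {d} n≡ = dimension-⊕ (BL n) (BL n) (BL (suc n))
  (harmonic-subspace (suc j)) (harmonic-subspace j) φ-linear ψ-linear into-φ into-ψ inj onto
  where
  open ≃-Reasoning
  r : ℝ
  r = proj₁ (fromℕ-unit (suc d))
  rd≃1 : r *ʳ fromℕ (suc d) ≃ 1ℝ
  rd≃1 = proj₂ (fromℕ-unit (suc d))
  rdx≃x : ∀ x → r *ʳ (fromℕ (suc d) *ʳ x) ≃ x
  rdx≃x x = ≃-trans (≃-sym (*-assoc r (fromℕ (suc d)) x)) (≃-trans (*-congʳ rd≃1) (*-identityˡ x))
  φ ψ : (Subset n → ℝ) → Subset (suc n) → ℝ
  φ g = glue g 𝟎
  ψ h = glue ((-ʳ r) • U h) h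
  φ-linear : Linear φ
  φ-linear = record
    { resp   = λ { f≋g (outside ∷ S) → f≋g S ; f≋g (inside ∷ S) → ≃-refl }
    ; +-homo = λ { f g (outside ∷ S) → ≃-refl ; f g (inside ∷ S) → ≃-sym (+-identityʳ 0ℝ) }
    ; •-homo = λ { c f (outside ∷ S) → ≃-refl ; c f (inside ∷ S) → ≃-sym (zeroʳ c) }
    }
  ψ-linear : Linear ψ
  ψ-linear = record
    { resp   = λ { f≋g (outside ∷ S) → *-congˡ (Uₗ.resp f≋g S) ; f≋g (inside ∷ S) → f≋g S }
    ; +-homo = λ { f g (outside ∷ S) → ≃-trans (*-congˡ (Uₗ.+-homo f g S)) (distribˡ (-ʳ r) _ _)
                 ; f g (inside ∷ S) → ≃-refl }
    ; •-homo = λ { c f (outside ∷ S) → ≃-trans (*-congˡ (Uₗ.•-homo c f S)) (exchange c (U f S))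
                 ; c f (inside ∷ S) → ≃-refl }
    }
    where
    exchange : ∀ c x → (-ʳ r) *ʳ (c *ʳ x) ≃ c *ʳ ((-ʳ r) *ʳ x)
    exchange c x = pointwise λ m →
      solve 3 (λ r c x → (:- r) :* (c :* x) := c :* ((:- r) :* x)) refl (seq r m) (seq c m) (seq x m)
  into-φ : ∀ {g} → Harmonic (suc j) g → Harmonic (suc j) (φ g)
  into-φ {g} (lev , Dg≋𝟎) = lev-φ , D-φ
    where
    lev-φ : Level (suc j) (φ g)
    lev-φ (outside ∷ S) = lev S
    lev-φ (inside  ∷ S) _ = ≃-refl
    D-φ : D (φ g) ≋ 𝟎
    D-φ (outside ∷ S) = ≃-trans (+-identityʳ (D g S)) (Dg≋𝟎 S)
    D-φ (inside  ∷ S) = Dₗ.𝟎-homo S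
  into-ψ : ∀ {h} → Harmonic j h → Harmonic (suc j) (ψ h)
  into-ψ {h} harm@(lev , Dh≋𝟎) = lev-ψ , D-ψ
    where
    lev-ψ : Level (suc j) (ψ h)
    lev-ψ (outside ∷ S) = level-• (-ʳ r) (U-level lev) S
    lev-ψ (inside  ∷ S) S≢ = lev S (S≢ ∘ cong suc)
    D-ψ : D (ψ h) ≋ 𝟎
    D-ψ (outside ∷ S) = begin
      D ((-ʳ r) • U h) S +ʳ h S                    ≈⟨ +-congʳ (Dₗ.•-homo (-ʳ r) (U h) S) ⟩
      (-ʳ r) *ʳ D (U h) S +ʳ h S                   ≈⟨ +-congʳ (*-congˡ (D-U-harmonic n≡ harm S)) ⟩
      (-ʳ r) *ʳ (fromℕ (suc d) *ʳ h S) +ʳ h S      ≈⟨ pointwise (λ m → solve 3 (λ r x y →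
                                                        (:- r) :* x :+ y := (:- (r :* x)) :+ y) refl
                                                        (seq r m) (seq (fromℕ (suc d) *ʳ h S) m) (seq (h S) m)) ⟩
      -ʳ (r *ʳ (fromℕ (suc d) *ʳ h S)) +ʳ h S      ≈⟨ +-congʳ (-ʳ-cong (rdx≃x (h S))) ⟩
      -ʳ h S +ʳ h S                                ≈⟨ -‿inverseˡ (h S) ⟩
      0ℝ                                           ∎
    D-ψ (inside  ∷ S) = Dh≋𝟎 S
  inj : ∀ {v w} → Harmonic (suc j) v → Harmonic j w → φ v ⊕ ψ w ≋ 𝟎 → v ≋ 𝟎 × w ≋ 𝟎
  inj {v} {w} _ _ sum≋𝟎 = v≋𝟎 , w≋𝟎
    where
    w≋𝟎 : w ≋ 𝟎
    w≋𝟎 S = ≃-trans (≃-sym (+-identityˡ (w S))) (sum≋𝟎 (inside ∷ S))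
    v≋𝟎 : v ≋ 𝟎
    v≋𝟎 S = begin
      v S                            ≈⟨ +-identityʳ (v S) ⟨
      v S +ʳ 0ℝ                      ≈⟨ +-congˡ (≃-trans (*-congˡ (Uₗ.vanish w≋𝟎 S)) (zeroʳ (-ʳ r))) ⟨
      v S +ʳ (-ʳ r) *ʳ U w S         ≈⟨ sum≋𝟎 (outside ∷ S) ⟩
      0ℝ                             ∎
  onto : ∀ {u} → Harmonic (suc j) u → ∃[ v ] ∃[ w ] Harmonic (suc j) v × Harmonic j w × u ≋ φ v ⊕ ψ w
  -- Adding `r • U h` undoes the correction built into `ψ`: its image under `D` is `h`, which
  -- cancels D g = - h.
  onto {u} (lev , Du≋𝟎) = g ⊕ r • U h , h , (lev-g₀ , Dg₀≋𝟎) , harm-h , decompose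
    where
    g h : Subset n → ℝ
    g S = u (outside ∷ S)
    h S = u (inside ∷ S)
    harm-h : Harmonic j h
    harm-h = (λ S S≢ → lev (inside ∷ S) (S≢ ∘ ℕ.suc-injective)) , λ S → Du≋𝟎 (inside ∷ S)
    lev-g₀ : Level (suc j) (g ⊕ r • U h)
    lev-g₀ = level-⊕ (λ S → lev (outside ∷ S)) (level-• r (U-level (proj₁ harm-h)))
    Dg₀≋𝟎 : D (g ⊕ r • U h) ≋ 𝟎
    Dg₀≋𝟎 S = begin
      D (g ⊕ r • U h) S                            ≈⟨ Dₗ.+-homo g (r • U h) S ⟩
      D g S +ʳ D (r • U h) S                       ≈⟨ +-congˡ (Dₗ.•-homo r (U h) S) ⟩
      D g S +ʳ r *ʳ D (U h) S                      ≈⟨ +-congˡ (*-congˡ (D-U-harmonic n≡ harm-h S)) ⟩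
      D g S +ʳ r *ʳ (fromℕ (suc d) *ʳ h S)         ≈⟨ +-congˡ (rdx≃x (h S)) ⟩
      D g S +ʳ h S                                 ≈⟨ Du≋𝟎 (outside ∷ S) ⟩
      0ℝ                                           ∎
    decompose : u ≋ φ (g ⊕ r • U h) ⊕ ψ h
    decompose (outside ∷ S) = pointwise λ m →
      solve 3 (λ g r x → g := (g :+ r :* x) :+ (:- r) :* x) refl (seq (g S) m) (seq r m) (seq (U h S) m)
    decompose (inside  ∷ S) = ≃-sym (+-identityˡ (h S))

harmonic-dimension-middle : ∀ {n j} → n ≡ j ℕ.+ suc j → Spectrum.HasDimension (BL n) (Harmonic (suc j)) 0
harmonic-dimension-middle n≡ = (λ ()) , record
  { members     = λ ()
  ; independent = λ _ _ ()
  ; spanning    = λ f (lev , Df≋𝟎) → (λ ()) , D-injective-middle n≡ lev Df≋𝟎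
  }

-- The bound admits the upper middle level of an odd row, because the recursion reaches it in row n
-- when n = 2j + 1. At that level the dimension is 0 for a separate reason, since the correction
-- term of the splitting would have denominator 0.
harmonic-dimension : ∀ n j → j ℕ.+ j ℕ.≤ suc n →
                     Spectrum.HasDimension (BL n) (Harmonic j) (binomial-difference n j)
harmonic-dimension n       zero    _ = subst (Spectrum.HasDimension (BL n) (Harmonic 0)) (≡.sym (nC0≡1 n)) (harmonic-dimension-0 n)
harmonic-dimension zero    (suc j) (s≤s le) = contradiction (subst (ℕ._≤ 0) (ℕ.+-suc j j) le) λ ()
harmonic-dimension (suc n) (suc j) (s≤s le) = go (n ∸ (j ℕ.+ j)) (≡.sym (ℕ.m+[n∸m]≡n 2j≤n))
  where
  2j≤n : j ℕ.+ j ℕ.≤ n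
  2j≤n = ℕ.≤-pred (subst (ℕ._≤ suc n) (ℕ.+-suc j j) le)
  go : ∀ d → n ≡ j ℕ.+ j ℕ.+ d →
       Spectrum.HasDimension (BL (suc n)) (Harmonic (suc j)) (binomial-difference (suc n) (suc j))
  go zero n≡ = subst (Spectrum.HasDimension (BL (suc n)) (Harmonic (suc j)))
    (≡.sym (≡.trans (cong (λ m → binomial-difference (suc m) (suc j)) n≡2j) (binomial-difference-middle j)))
    (harmonic-dimension-middle (≡.trans (cong suc n≡2j) (≡.sym (ℕ.+-suc j j))))
    where
    n≡2j : n ≡ j ℕ.+ j
    n≡2j = ≡.trans n≡ (ℕ.+-identityʳ (j ℕ.+ j))
  go (suc d) n≡ = subst (Spectrum.HasDimension (BL (suc n)) (Harmonic (suc j)))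
    (≡.sym (binomial-difference-suc n j 2j+2≤n+1))
    (harmonic-dimension-suc n≡ (harmonic-dimension n (suc j) 2j+2≤n+1) (harmonic-dimension n j (ℕ.m≤n⇒m≤1+n 2j≤n)))
    where
    2j+2≤n+1 : suc j ℕ.+ suc j ℕ.≤ suc n
    2j+2≤n+1 = below-middle n≡

-- Eigenvectors of D U on a level

Eigen : ∀ {n} → ℕ → ℝ → (Subset n → ℝ) → Set
Eigen i a f = Level i f × D (U f) ≋ a • f

eigen-subspace : ∀ {n} i a → IsSubspace (Eigen {n} i a)
eigen-subspace i a = record
  { resp     = λ f≋g (lev , eig) → level-resp f≋g lev , λ S →
      ≃-trans (Dₗ.resp (Uₗ.resp (λ T → ≃-sym (f≋g T))) S) (≃-trans (eig S) (*-congˡ (f≋g S)))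
  ; 𝟎-closed = (λ _ _ → ≃-refl) , λ S → ≃-trans (Dₗ.vanish Uₗ.𝟎-homo S) (≃-sym (zeroʳ a))
  ; ⊕-closed = λ {f} {g} (p , eig-f) (q , eig-g) → level-⊕ p q , λ S → begin
      D (U (f ⊕ g)) S                  ≈⟨ Dₗ.resp (Uₗ.+-homo f g) S ⟩
      D (U f ⊕ U g) S                  ≈⟨ Dₗ.+-homo (U f) (U g) S ⟩
      D (U f) S +ʳ D (U g) S           ≈⟨ +ʳ-cong (eig-f S) (eig-g S) ⟩
      a *ʳ f S +ʳ a *ʳ g S             ≈⟨ distribˡ a (f S) (g S) ⟨
      a *ʳ (f S +ʳ g S)                ∎
  ; •-closed = λ c {f} (p , eig) → level-• c p , λ S → begin
      D (U (c • f)) S                  ≈⟨ Dₗ.resp (Uₗ.•-homo c f) S ⟩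
      D (c • U f) S                    ≈⟨ Dₗ.•-homo c (U f) S ⟩
      c *ʳ D (U f) S                   ≈⟨ *-congˡ (eig S) ⟩
      c *ʳ (a *ʳ f S)                  ≈⟨ x∙yz≈y∙xz c a (f S) ⟩
      a *ʳ (c *ʳ f S)                  ∎
  }
  where open ≃-Reasoning

harmonic⇒eigen : ∀ {n j d} {f : Subset n → ℝ} → n ≡ j ℕ.+ j ℕ.+ d → Harmonic j f → Eigen j (fromℕ d) f
harmonic⇒eigen n≡ harm = proj₁ harm , D-U-harmonic n≡ harm

-- Here d is the smallest eigenvalue: the commutator leaves U (D f) = 0, and `U` is injective one
-- level lower, where the parameter is d + 2.
eigen⇒harmonic : ∀ {n j d} {f : Subset n → ℝ} → n ≡ j ℕ.+ j ℕ.+ d → Eigen j (fromℕ d) f → Harmonic j f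
eigen⇒harmonic {j = zero}  n≡ (lev , _) = lev , D-level-0 lev
eigen⇒harmonic {n} {suc j} {d} {f} n≡ (lev , eig) = lev ,
  U-injective {d = suc d} (≡.trans n≡ (levels j d)) (D-level lev) λ S → begin
    U (D f) S                              ≈⟨ U-D-eigenvector n≡ lev eig S ⟩
    (fromℕ d - fromℕ d) *ʳ f S             ≈⟨ *-congʳ (-‿inverseʳ (fromℕ d)) ⟩
    0ℝ *ʳ f S                              ≈⟨ zeroˡ (f S) ⟩
    0ℝ                                     ∎
  where open ≃-Reasoning

-- U is an isomorphism between eigenspaces on consecutive levels, with inverse D / a.
eigen-dimension-suc : ∀ {n i d a m} → .{{ℕ.NonZero a}} → n ≡ i ℕ.+ i ℕ.+ (2 ℕ.+ d) →
                      Spectrum.HasDimension (BL n) (Eigen i (fromℕ a)) m →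
                      Spectrum.HasDimension (BL n) (Eigen (suc i) (fromℕ (d ℕ.+ a))) m
eigen-dimension-suc {n} {i} {d} {a} n≡ = dimension-≅ (BL n) (BL n) (eigen-subspace i (fromℕ a)) U-linear
  into (λ (lev , _) → U-injective {d = suc d} n≡ lev) onto
  where
  open ≃-Reasoning
  n≡′ : n ≡ suc i ℕ.+ suc i ℕ.+ d
  n≡′ = ≡.trans n≡ (≡.sym (levels i d))
  r : ℝ
  r = proj₁ (fromℕ-unit a)
  rax≃x : ∀ x → r *ʳ (fromℕ a *ʳ x) ≃ x
  rax≃x x = ≃-trans (≃-sym (*-assoc r (fromℕ a) x)) (≃-trans (*-congʳ (proj₂ (fromℕ-unit a))) (*-identityˡ x))
  into : ∀ {f} → Eigen i (fromℕ a) f → Eigen (suc i) (fromℕ (d ℕ.+ a)) (U f)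
  into {f} (lev , eig) = U-level lev , λ S → begin
    D (U (U f)) S                                ≈⟨ commutator-level n≡′ (U-level lev) S ⟩
    U (D (U f)) S +ʳ fromℕ d *ʳ U f S            ≈⟨ +-congʳ (Uₗ.resp eig S) ⟩
    U (fromℕ a • f) S +ʳ fromℕ d *ʳ U f S        ≈⟨ +-congʳ (Uₗ.•-homo (fromℕ a) f S) ⟩
    fromℕ a *ʳ U f S +ʳ fromℕ d *ʳ U f S         ≈⟨ +-comm _ _ ⟩
    fromℕ d *ʳ U f S +ʳ fromℕ a *ʳ U f S         ≈⟨ distribʳ (U f S) (fromℕ d) (fromℕ a) ⟨
    (fromℕ d +ʳ fromℕ a) *ʳ U f S                ≈⟨ *-congʳ (fromℕ-+ d a) ⟨
    fromℕ (d ℕ.+ a) *ʳ U f S                     ∎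
  onto : ∀ {f} → Eigen (suc i) (fromℕ (d ℕ.+ a)) f → ∃[ g ] Eigen i (fromℕ a) g × f ≋ U g
  onto {f} (lev , eig) = r • D f , (level-• r (D-level lev) , eig-g) , λ S → begin
    f S                              ≈⟨ rax≃x (f S) ⟨
    r *ʳ (fromℕ a *ʳ f S)            ≈⟨ *-congˡ (UDf S) ⟨
    r *ʳ U (D f) S                   ≈⟨ Uₗ.•-homo r (D f) S ⟨
    U (r • D f) S                    ∎
    where
    UDf : U (D f) ≋ fromℕ a • f
    UDf S = begin
      U (D f) S                                        ≈⟨ U-D-eigenvector n≡′ lev eig S ⟩
      (fromℕ (d ℕ.+ a) - fromℕ d) *ʳ f S               ≈⟨ *-congʳ (+-congʳ (fromℕ-+ d a)) ⟩
      ((fromℕ d +ʳ fromℕ a) - fromℕ d) *ʳ f S          ≈⟨ *-congʳ (+-congʳ (+-comm (fromℕ d) (fromℕ a))) ⟩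
      ((fromℕ a +ʳ fromℕ d) - fromℕ d) *ʳ f S          ≈⟨ *-congʳ (x≃x+y-y (fromℕ a) (fromℕ d)) ⟨
      fromℕ a *ʳ f S                                   ∎
    eig-g : D (U (r • D f)) ≋ fromℕ a • (r • D f)
    eig-g S = begin
      D (U (r • D f)) S              ≈⟨ Dₗ.resp (Uₗ.•-homo r (D f)) S ⟩
      D (r • U (D f)) S              ≈⟨ Dₗ.•-homo r (U (D f)) S ⟩
      r *ʳ D (U (D f)) S             ≈⟨ *-congˡ (≃-trans (Dₗ.resp UDf S) (Dₗ.•-homo (fromℕ a) f S)) ⟩
      r *ʳ (fromℕ a *ʳ D f S)        ≈⟨ x∙yz≈y∙xz r (fromℕ a) (D f S) ⟩
      fromℕ a *ʳ (r *ʳ D f S)        ∎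

-- `t` counts the applications of `U` that lead up from the harmonic functions of level j. The
-- increments d, d + 2, ..., d + 2t collected on the way add up to (t + 1)(t + d).
eigen-dimension : ∀ t {n j d} → n ≡ (t ℕ.+ j) ℕ.+ (t ℕ.+ j) ℕ.+ d →
                  Spectrum.HasDimension (BL n) (Eigen (t ℕ.+ j) (fromℕ (suc t ℕ.* (t ℕ.+ d)))) (binomial-difference n j)
eigen-dimension zero {n} {j} {d} n≡ =
  subst (λ a → Spectrum.HasDimension (BL n) (Eigen j (fromℕ a)) (binomial-difference n j)) (≡.sym (ℕ.*-identityˡ d))
    (dimension-≅ (BL n) (BL n) (harmonic-subspace j)
      (record { resp = λ f≋g → f≋g ; +-homo = λ _ _ _ → ≃-refl ; •-homo = λ _ _ _ → ≃-refl })
      (harmonic⇒eigen n≡) (λ _ f≋𝟎 → f≋𝟎) (λ {f} eig → f , eigen⇒harmonic n≡ eig , λ _ → ≃-refl)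
      (harmonic-dimension n j (ℕ.m≤n⇒m≤1+n (subst (j ℕ.+ j ℕ.≤_) (≡.sym n≡) (ℕ.m≤m+n (j ℕ.+ j) d)))))
eigen-dimension (suc t) {n} {j} {d} n≡ =
  subst (λ a → Spectrum.HasDimension (BL n) (Eigen (suc t ℕ.+ j) (fromℕ a)) (binomial-difference n j)) (eigenvalue t d)
    -- The eigenvalue one level lower is positive even for d = 0, because its second factor contains
    -- the summand 2.
    (eigen-dimension-suc {{nonZero t}} n≡′ (eigen-dimension t n≡′))
  where
  n≡′ : n ≡ (t ℕ.+ j) ℕ.+ (t ℕ.+ j) ℕ.+ (2 ℕ.+ d)
  n≡′ = ≡.trans n≡ (levels (t ℕ.+ j) d)
  eigenvalue : ∀ t d → d ℕ.+ suc t ℕ.* (t ℕ.+ (2 ℕ.+ d)) ≡ suc (suc t) ℕ.* (suc t ℕ.+ d)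
  eigenvalue = solve-∀
  nonZero : ∀ t → ℕ.NonZero (suc t ℕ.* (t ℕ.+ (2 ℕ.+ d)))
  nonZero zero    = _
  nonZero (suc t) = _

-- Sums over lists

∑ₗ : ∀ {A : Set} → (A → ℝ) → List A → ℝ
∑ₗ f xs = foldr _+ʳ_ 0ℝ (map f xs)

∑ₗ-cong : ∀ {A : Set} {f g : A → ℝ} → f ≋ g → ∀ xs → ∑ₗ f xs ≃ ∑ₗ g xs
∑ₗ-cong f≋g []       = ≃-refl
∑ₗ-cong f≋g (x ∷ xs) = +ʳ-cong (f≋g x) (∑ₗ-cong f≋g xs)

∑ₗ-zero : ∀ {A : Set} {f : A → ℝ} → f ≋ 𝟎 → ∀ xs → ∑ₗ f xs ≃ 0ℝ
∑ₗ-zero f≋𝟎 []       = ≃-refl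
∑ₗ-zero f≋𝟎 (x ∷ xs) = ≃-trans (+ʳ-cong (f≋𝟎 x) (∑ₗ-zero f≋𝟎 xs)) (+-identityʳ 0ℝ)

∑ₗ-++ : ∀ {A : Set} (f : A → ℝ) xs ys → ∑ₗ f (xs ++ ys) ≃ ∑ₗ f xs +ʳ ∑ₗ f ys
∑ₗ-++ f []       ys = ≃-sym (+-identityˡ _)
∑ₗ-++ f (x ∷ xs) ys = ≃-trans (+-congˡ (∑ₗ-++ f xs ys)) (≃-sym (+-assoc (f x) _ _))

∑ₗ-map : ∀ {A B : Set} (f : B → ℝ) (h : A → B) xs → ∑ₗ f (map h xs) ≃ ∑ₗ (f ∘ h) xs
∑ₗ-map f h []       = ≃-refl
∑ₗ-map f h (x ∷ xs) = +-congˡ (∑ₗ-map f h xs)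

∑ₗ-subsets : ∀ n (f : Subset (suc n) → ℝ) → ∑ₗ f (subsets (suc n)) ≃
             ∑ₗ (f ∘ (outside ∷_)) (subsets n) +ʳ ∑ₗ (f ∘ (inside ∷_)) (subsets n)
∑ₗ-subsets n f = ≃-trans (∑ₗ-++ f (map (outside ∷_) (subsets n)) (map (inside ∷_) (subsets n)))
  (+ʳ-cong (∑ₗ-map f (outside ∷_) (subsets n)) (∑ₗ-map f (inside ∷_) (subsets n)))

module _ {A : Set} {P : A → Set} (P? : Unary.Decidable P) where

  -- Extension by zero moves sums over the vertices of an induced subgraph to all subsets, where
  -- recursion on the first element is possible.
  extend : ([ x ∈ A ∣ P x ] → ℝ) → A → ℝ
  extend v x with P? x
  ... | yes p = v (x , [ p ])
  ... | no  _ = 0ℝ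

  ∑ₗ-refine : ∀ (v : [ x ∈ A ∣ P x ] → ℝ) xs → ∑ₗ v (refine-list P? xs) ≃ ∑ₗ (extend v) xs
  ∑ₗ-refine v [] = ≃-refl
  ∑ₗ-refine v (x ∷ xs) with P? x
  ... | yes p = +-congˡ (∑ₗ-refine v xs)
  ... | no  _ = ≃-trans (∑ₗ-refine v xs) (≃-sym (+-identityˡ _))

  extend-scale : ∀ (c : A → ℝ) v → extend (λ y → c (value y) *ʳ v y) ≋ λ x → c x *ʳ extend v x
  extend-scale c v x with P? x
  ... | yes p = ≃-refl
  ... | no  _ = ≃-sym (zeroʳ (c x))

  extend-unique : ∀ {v w} → (∀ y → v y ≃ w (value y)) → (∀ x → ¬ P x → w x ≃ 0ℝ) → extend v ≋ w
  extend-unique v≃w w≃0 x with P? x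
  ... | yes p = v≃w (x , [ p ])
  ... | no ¬p = ≃-sym (w≃0 x ¬p)

-- The adjacency operator

indicator : Bool → ℝ
indicator b = if b then 1ℝ else 0ℝ

∑ₗ-equal : ∀ {n} (f : Subset n → ℝ) S →
           ∑ₗ (λ T → indicator ⌊ ∣ S △ T ∣ ℕ.≟ 0 ⌋ *ʳ f T) (subsets n) ≃ f S
∑ₗ-equal f [] = ≃-trans (+-identityʳ _) (*-identityˡ _)
∑ₗ-equal {suc n} f (outside ∷ S) = ≃-trans (∑ₗ-subsets n _) (≃-trans
  (+ʳ-cong (∑ₗ-equal (f ∘ (outside ∷_)) S) (∑ₗ-zero (λ T → zeroˡ (f (inside ∷ T))) (subsets n)))
  (+-identityʳ (f (outside ∷ S))))
∑ₗ-equal {suc n} f (inside ∷ S) = ≃-trans (∑ₗ-subsets n _) (≃-trans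
  (+ʳ-cong (∑ₗ-zero (λ T → zeroˡ (f (outside ∷ T))) (subsets n)) (∑ₗ-equal (f ∘ (inside ∷_)) S))
  (+-identityˡ (f (inside ∷ S))))

-- The form that arises when two sets already differ in the first element: at distance one the
-- remaining parts must coincide.
∑ₗ-equal-suc : ∀ {n} (f : Subset n → ℝ) S →
               ∑ₗ (λ T → indicator ⌊ suc ∣ S △ T ∣ ℕ.≟ 1 ⌋ *ʳ f T) (subsets n) ≃ f S
∑ₗ-equal-suc {n} f S = ≃-trans (∑ₗ-cong (λ T → *-congʳ (shift ∣ S △ T ∣)) (subsets n)) (∑ₗ-equal f S)
  where
  shift : ∀ m → indicator ⌊ suc m ℕ.≟ 1 ⌋ ≃ indicator ⌊ m ℕ.≟ 0 ⌋
  shift zero    = ≃-refl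
  shift (suc _) = ≃-refl

-- Splitting by the first element, either the sets agree there and the rest is adjacent, or they
-- differ there and the rest is equal. These two cases are the recursion of `D` and `U`.
∑ₗ-adjacent : ∀ {n} (f : Subset n → ℝ) S →
              ∑ₗ (λ T → indicator ⌊ ∣ S △ T ∣ ℕ.≟ 1 ⌋ *ʳ f T) (subsets n) ≃ D f S +ʳ U f S
∑ₗ-adjacent f [] = +-congʳ (zeroˡ (f []))
∑ₗ-adjacent {suc n} f (outside ∷ S) = ≃-trans (∑ₗ-subsets n _) (≃-trans
  (+ʳ-cong (∑ₗ-adjacent (f ∘ (outside ∷_)) S) (∑ₗ-equal-suc (f ∘ (inside ∷_)) S))
  (xy∙z≈xz∙y (D (f ∘ (outside ∷_)) S) (U (f ∘ (outside ∷_)) S) (f (inside ∷ S))))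
∑ₗ-adjacent {suc n} f (inside ∷ S) = ≃-trans (∑ₗ-subsets n _) (≃-trans
  (+ʳ-cong (∑ₗ-equal-suc (f ∘ (outside ∷_)) S) (∑ₗ-adjacent (f ∘ (inside ∷_)) S))
  (x∙yz≈y∙zx (f (outside ∷ S)) (D (f ∘ (inside ∷_)) S) (U (f ∘ (inside ∷_)) S)))

-- The adjacency operator on two consecutive levels

module TwoLevels (n i : ℕ) where

  open Graph (BL-levels n (suc i)) using (Vertex; vertices)
  open Spectrum (BL-levels n (suc i)) using (Vector; adjacency; _·_; Eigenspace; IsEigenvalue; HasDimension)

  InLevels : Subset n → Set
  InLevels S = ∣ S ∣ ≡ i ⊎ ∣ S ∣ ≡ suc i

  in-levels? : Unary.Decidable InLevels
  in-levels? S = (∣ S ∣ ℕ.≟ i) ⊎-dec (∣ S ∣ ℕ.≟ suc i)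

  -- The membership proof stored in a vertex is irrelevant; decidability recovers one that can be
  -- analysed by cases.
  in-levels : (y : Vertex) → InLevels (value y)
  in-levels (S , [ p ]) = recompute (in-levels? S) p

  restrict : (Subset n → ℝ) → Vector
  restrict f y = f (value y)

  -- On all subsets adjacency acts as D + U. The parts `D f` and `U g` live on levels i - 1 and i +
  -- 2, outside the graph, so only `D g` and `U f` remain.
  adjacency-action : ∀ {f g v} → Level i f → Level (suc i) g → v ≋ restrict (f ⊕ g) →
                     adjacency · v ≋ restrict (D g ⊕ U f)
  adjacency-action {f} {g} {v} lev-f lev-g v≋ y = begin
    (adjacency · v) y                                              ≈⟨ ∑ₗ-refine in-levels? _ (subsets n) ⟩
    ∑ₗ (extend in-levels? (λ z → a (value z) *ʳ v z)) (subsets n)  ≈⟨ ∑ₗ-cong (λ T → ≃-trans (extend-scale in-levels? a v T)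
                                                                        (*-congˡ (extended T))) (subsets n) ⟩
    ∑ₗ (λ T → a T *ʳ (f ⊕ g) T) (subsets n)                        ≈⟨ ∑ₗ-adjacent (f ⊕ g) S ⟩
    D (f ⊕ g) S +ʳ U (f ⊕ g) S                                     ≈⟨ +ʳ-cong (Dₗ.+-homo f g S) (Uₗ.+-homo f g S) ⟩
    (D f S +ʳ D g S) +ʳ (U f S +ʳ U g S)                           ≈⟨ +ʳ-cong (+-congʳ Df≃0) (+-congˡ Ug≃0) ⟩
    (0ℝ +ʳ D g S) +ʳ (U f S +ʳ 0ℝ)                                 ≈⟨ +ʳ-cong (+-identityˡ _) (+-identityʳ _) ⟩
    D g S +ʳ U f S                                                 ∎
    where
    open ≃-Reasoning
    S : Subset n
    S = value y
    a : Subset n → ℝ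
    a T = indicator ⌊ ∣ S △ T ∣ ℕ.≟ 1 ⌋
    extended : extend in-levels? v ≋ f ⊕ g
    extended = extend-unique in-levels? v≋ λ T T∉ →
      ≃-trans (+ʳ-cong (lev-f T (T∉ ∘ inj₁)) (lev-g T (T∉ ∘ inj₂))) (+-identityʳ 0ℝ)
    i≢1+S : ∀ {m} → m ≡ i ⊎ m ≡ suc i → suc m ≢ i
    i≢1+S (inj₁ refl) = ℕ.1+n≢n
    i≢1+S (inj₂ refl) eq = ℕ.m≢1+n+m i (≡.sym eq)
    S≢2+i : ∀ {m} → m ≡ i ⊎ m ≡ suc i → suc (suc i) ≢ m
    S≢2+i (inj₁ refl) eq = ℕ.m≢1+n+m i (≡.sym eq)
    S≢2+i (inj₂ refl) = ℕ.1+n≢n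
    Df≃0 : D f S ≃ 0ℝ
    Df≃0 = D-local f S λ T T≡ → lev-f T λ T≡i → i≢1+S (in-levels y) (≡.trans (≡.sym T≡) T≡i)
    Ug≃0 : U g S ≃ 0ℝ
    Ug≃0 = U-local g S λ T T≡ → lev-g T λ T≡1+i → S≢2+i (in-levels y) (≡.trans (cong suc (≡.sym T≡1+i)) T≡)

  restrict-injective : ∀ {f f′ g g′} → Level i f → Level i f′ → Level (suc i) g → Level (suc i) g′ →
                       restrict (f ⊕ g) ≋ restrict (f′ ⊕ g′) → f ≋ f′ × g ≋ g′
  restrict-injective {f} {f′} {g} {g′} lev-f lev-f′ lev-g lev-g′ eq = f≋f′ , g≋g′
    where
    open ≃-Reasoning
    f≋f′ : f ≋ f′
    f≋f′ S with ∣ S ∣ ℕ.≟ i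
    ... | no S≢i = ≃-trans (lev-f S S≢i) (≃-sym (lev-f′ S S≢i))
    ... | yes S≡i = begin
      f S              ≈⟨ ≃-trans (+-congˡ (lev-g S S≢1+i)) (+-identityʳ (f S)) ⟨
      f S +ʳ g S       ≈⟨ eq (S , [ inj₁ S≡i ]) ⟩
      f′ S +ʳ g′ S     ≈⟨ ≃-trans (+-congˡ (lev-g′ S S≢1+i)) (+-identityʳ (f′ S)) ⟩
      f′ S             ∎
      where
      S≢1+i : ∣ S ∣ ≢ suc i
      S≢1+i S≡1+i = ℕ.1+n≢n (≡.trans (≡.sym S≡1+i) S≡i)
    g≋g′ : g ≋ g′
    g≋g′ S with ∣ S ∣ ℕ.≟ suc i
    ... | no S≢1+i = ≃-trans (lev-g S S≢1+i) (≃-sym (lev-g′ S S≢1+i))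
    ... | yes S≡1+i = begin
      g S              ≈⟨ ≃-trans (+-congʳ (lev-f S S≢i)) (+-identityˡ (g S)) ⟨
      f S +ʳ g S       ≈⟨ eq (S , [ inj₂ S≡1+i ]) ⟩
      f′ S +ʳ g′ S     ≈⟨ ≃-trans (+-congʳ (lev-f′ S S≢i)) (+-identityˡ (g′ S)) ⟩
      g′ S             ∎
      where
      S≢i : ∣ S ∣ ≢ i
      S≢i S≡i = ℕ.1+n≢n (≡.trans (≡.sym S≡1+i) S≡i)

  decompose : ∀ v → ∃[ f ] ∃[ g ] Level i f × Level (suc i) g × v ≋ restrict (f ⊕ g)
  decompose v = f , g , lev-f , lev-g , v≋
    where
    f g : Subset n → ℝ
    f S with ∣ S ∣ ℕ.≟ i
    ... | yes S≡i = v (S , [ inj₁ S≡i ])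
    ... | no  _   = 0ℝ
    g S with ∣ S ∣ ℕ.≟ suc i
    ... | yes S≡1+i = v (S , [ inj₂ S≡1+i ])
    ... | no  _     = 0ℝ
    lev-f : Level i f
    lev-f S S≢i with ∣ S ∣ ℕ.≟ i
    ... | yes S≡i = contradiction S≡i S≢i
    ... | no  _   = ≃-refl
    lev-g : Level (suc i) g
    lev-g S S≢1+i with ∣ S ∣ ℕ.≟ suc i
    ... | yes S≡1+i = contradiction S≡1+i S≢1+i
    ... | no  _     = ≃-refl
    v≋ : v ≋ restrict (f ⊕ g)
    v≋ y with ∣ value y ∣ ℕ.≟ i | ∣ value y ∣ ℕ.≟ suc i
    ... | yes S≡i | yes S≡1+i = contradiction (≡.trans (≡.sym S≡1+i) S≡i) ℕ.1+n≢n
    ... | yes _   | no _      = ≃-sym (+-identityʳ (v y))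
    ... | no _    | yes _     = ≃-sym (+-identityˡ (v y))
    ... | no S≢i  | no S≢1+i  = contradiction (in-levels y) [ S≢i , S≢1+i ]′

  square-eigenvector : ∀ {μ} {f g : Subset n → ℝ} → D g ≋ μ • f → U f ≋ μ • g → D (U f) ≋ (μ *ʳ μ) • f
  square-eigenvector {μ} {f} {g} Dg≋ Uf≋ S = begin
    D (U f) S                 ≈⟨ Dₗ.resp Uf≋ S ⟩
    D (μ • g) S               ≈⟨ Dₗ.•-homo μ g S ⟩
    μ *ʳ D g S                ≈⟨ *-congˡ (Dg≋ S) ⟩
    μ *ʳ (μ *ʳ f S)           ≈⟨ *-assoc μ μ (f S) ⟨
    (μ *ʳ μ) *ʳ f S           ∎
    where open ≃-Reasoning

  eigenspace⁺ : ∀ {μ f g v} → Level i f → Level (suc i) g → v ≋ restrict (f ⊕ g) →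
                D g ≋ μ • f → U f ≋ μ • g → Eigenspace adjacency μ v
  eigenspace⁺ {μ} {f} {g} lev-f lev-g v≋ Dg≋ Uf≋ y = ≃-trans (adjacency-action lev-f lev-g v≋ y)
    (≃-trans (+ʳ-cong (Dg≋ (value y)) (Uf≋ (value y)))
      (≃-trans (≃-sym (distribˡ μ (f (value y)) (g (value y)))) (*-congˡ (≃-sym (v≋ y)))))

  eigenspace⁻ : ∀ {μ v f g} → Level i f → Level (suc i) g → v ≋ restrict (f ⊕ g) →
                Eigenspace adjacency μ v → D g ≋ μ • f × U f ≋ μ • g
  eigenspace⁻ {μ} {v} {f} {g} lev-f lev-g v≋ eig = restrict-injective
    (D-level lev-g) (level-• μ lev-f) (U-level lev-f) (level-• μ lev-g)
    λ y → ≃-trans (≃-sym (adjacency-action lev-f lev-g v≋ y))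
      (≃-trans (eig y) (≃-trans (*-congˡ (v≋ y)) (distribˡ μ (f (value y)) (g (value y)))))

  nonzero-eigenspace-dimension : ∀ {μ a r m} → μ *ʳ μ ≃ a → a *ʳ r ≃ 1ℝ →
    Spectrum.HasDimension (BL n) (Eigen i a) m → HasDimension (Eigenspace adjacency μ) m
  nonzero-eigenspace-dimension {μ} {a} {r} μμ≃a ar≃1 = dimension-≅ (BL n) (BL-levels n (suc i)) (eigen-subspace i a)
    φ-linear into inj onto
    where
    open ≃-Reasoning
    s : ℝ
    -- This is 1/μ, obtained from the inverse `r` of a = μ², so that only `a` has to be inverted.
    s = μ *ʳ r
    μs≃1 : μ *ʳ s ≃ 1ℝ
    μs≃1 = ≃-trans (≃-sym (*-assoc μ μ r)) (≃-trans (*-congʳ μμ≃a) ar≃1)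
    sa≃μ : s *ʳ a ≃ μ
    sa≃μ = ≃-trans (*-assoc μ r a) (≃-trans (*-congˡ (≃-trans (*-comm r a) ar≃1)) (*-identityʳ μ))
    lift : (Subset n → ℝ) → Subset n → ℝ
    lift f = s • U f
    φ-linear : Linear (λ f → restrict (f ⊕ lift f))
    φ-linear = record
      { resp   = λ f≋g y → +ʳ-cong (f≋g (value y)) (*-congˡ (Uₗ.resp f≋g (value y)))
      ; +-homo = λ f g y → ≃-trans (+-congˡ (≃-trans (*-congˡ (Uₗ.+-homo f g (value y))) (distribˡ s _ _)))
                             (interchange (f (value y)) (g (value y)) _ _)
      ; •-homo = λ c f y → ≃-trans (+-congˡ (≃-trans (*-congˡ (Uₗ.•-homo c f (value y))) (x∙yz≈y∙xz s c _)))
                             (≃-sym (distribˡ c (f (value y)) _))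
      }
    into : ∀ {f} → Eigen i a f → Eigenspace adjacency μ (restrict (f ⊕ lift f))
    into {f} (lev , eig) = eigenspace⁺ {f = f} {g = lift f} lev (level-• s (U-level lev)) (λ _ → ≃-refl)
      (λ S → begin
        D (s • U f) S             ≈⟨ Dₗ.•-homo s (U f) S ⟩
        s *ʳ D (U f) S            ≈⟨ *-congˡ (eig S) ⟩
        s *ʳ (a *ʳ f S)           ≈⟨ *-assoc s a (f S) ⟨
        (s *ʳ a) *ʳ f S           ≈⟨ *-congʳ sa≃μ ⟩
        μ *ʳ f S                  ∎)
      (λ S → begin
        U f S                     ≈⟨ *-identityˡ (U f S) ⟨
        1ℝ *ʳ U f S               ≈⟨ *-congʳ μs≃1 ⟨
        (μ *ʳ s) *ʳ U f S         ≈⟨ *-assoc μ s (U f S) ⟩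
        μ *ʳ (s *ʳ U f S)         ∎)
    inj : ∀ {f} → Eigen i a f → restrict (f ⊕ lift f) ≋ 𝟎 → f ≋ 𝟎
    inj {f} (lev , _) ≋𝟎 = proj₁ (restrict-injective {f′ = 𝟎} {g′ = 𝟎} lev (λ _ _ → ≃-refl)
      (level-• s (U-level lev)) (λ _ _ → ≃-refl) λ y → ≃-trans (≋𝟎 y) (≃-sym (+-identityʳ 0ℝ)))
    onto : ∀ {v} → Eigenspace adjacency μ v → ∃[ f ] Eigen i a f × v ≋ restrict (f ⊕ lift f)
    onto {v} eig =
      let (f , g , lev-f , lev-g , v≋) = decompose v
          (Dg≋ , Uf≋) = eigenspace⁻ lev-f lev-g v≋ eig
      in f , (lev-f , eig-f Dg≋ Uf≋) , λ y → ≃-trans (v≋ y) (+-congˡ (g≋ Dg≋ Uf≋ (value y)))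
      where
      module _ {f g : Subset n → ℝ} (Dg≋ : D g ≋ μ • f) (Uf≋ : U f ≋ μ • g) where
        eig-f : D (U f) ≋ a • f
        eig-f S = ≃-trans (square-eigenvector Dg≋ Uf≋ S) (*-congʳ μμ≃a)
        g≋ : g ≋ s • U f
        g≋ S = begin
          g S                       ≈⟨ *-identityˡ (g S) ⟨
          1ℝ *ʳ g S                 ≈⟨ *-congʳ (≃-trans (*-comm s μ) μs≃1) ⟨
          (s *ʳ μ) *ʳ g S           ≈⟨ *-assoc s μ (g S) ⟩
          s *ʳ (μ *ʳ g S)           ≈⟨ *-congˡ (Uf≋ S) ⟨
          s *ʳ U f S                ∎

  module _ {d : ℕ} (n≡ : n ≡ i ℕ.+ i ℕ.+ suc d) where

    -- For μ = 0 the equations decouple into D g = 0 and U f = 0. Level i lies strictly below the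
    -- middle, so the second forces f = 0 and leaves the harmonic `g`.
    zero-eigenspace-dimension : HasDimension (Eigenspace adjacency 0ℝ) (binomial-difference n (suc i))
    zero-eigenspace-dimension = dimension-≅ (BL n) (BL-levels n (suc i)) (harmonic-subspace (suc i))
      (record { resp = λ f≋g y → f≋g (value y) ; +-homo = λ _ _ _ → ≃-refl ; •-homo = λ _ _ _ → ≃-refl })
      into inj onto (harmonic-dimension n (suc i) (below-middle n≡))
      where
      into : ∀ {g} → Harmonic (suc i) g → Eigenspace adjacency 0ℝ (restrict g)
      into {g} (lev , Dg≋𝟎) = eigenspace⁺ {f = 𝟎} {g = g} (λ _ _ → ≃-refl) lev (λ y → ≃-sym (+-identityˡ (g (value y))))
        (λ S → ≃-trans (Dg≋𝟎 S) (≃-sym (zeroˡ 0ℝ))) (λ S → ≃-trans (Uₗ.𝟎-homo S) (≃-sym (zeroˡ (g S))))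
      inj : ∀ {g} → Harmonic (suc i) g → restrict g ≋ 𝟎 → g ≋ 𝟎
      inj {g} (lev , _) g≋𝟎 = proj₂ (restrict-injective {f = 𝟎} {f′ = 𝟎} {g′ = 𝟎} (λ _ _ → ≃-refl) (λ _ _ → ≃-refl)
        lev (λ _ _ → ≃-refl) λ y → +-congˡ (g≋𝟎 y))
      onto : ∀ {v} → Eigenspace adjacency 0ℝ v → ∃[ g ] Harmonic (suc i) g × v ≋ restrict g
      onto {v} eig =
        let (f , g , lev-f , lev-g , v≋) = decompose v
            (Dg≋ , Uf≋) = eigenspace⁻ lev-f lev-g v≋ eig
            f≋𝟎 = U-injective n≡ lev-f λ S → ≃-trans (Uf≋ S) (zeroˡ (g S))
        in g , (lev-g , λ S → ≃-trans (Dg≋ S) (zeroˡ (f S))) ,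
           λ y → ≃-trans (v≋ y) (≃-trans (+-congʳ (f≋𝟎 (value y))) (+-identityˡ (g (value y))))

    -- The lower half `f` of an eigenvector belongs to D U with eigenvalue μ² and vanishes; then μ g
    -- = U f = 0, and cancelling μ removes the upper half.
    regular⇒not-eigenvalue : ∀ {μ} → Regular μ →
      (∀ t j → t ℕ.+ j ≡ i → Regular (μ *ʳ μ - fromℕ (suc t ℕ.* (t ℕ.+ suc d)))) → ¬ IsEigenvalue adjacency μ
    regular⇒not-eigenvalue {μ} reg-μ reg (v , eig , x , vx#0) =
      let (f , g , lev-f , lev-g , v≋) = decompose v
          (Dg≋ , Uf≋) = eigenspace⁻ lev-f lev-g v≋ eig
          f≋𝟎 = regular⇒no-eigenvector i n≡ lev-f (square-eigenvector Dg≋ Uf≋) reg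
          g≋𝟎 = λ S → reg-μ (≃-trans (≃-sym (Uf≋ S)) (Uₗ.vanish f≋𝟎 S))
      in #⇒≄ vx#0 (≃-trans (v≋ x) (≃-trans (+ʳ-cong (f≋𝟎 (value x)) (g≋𝟎 (value x))) (+-identityʳ 0ℝ)))

-- Counting the vertices

length-filter-map : ∀ {A B : Set} {P : B → Set} (P? : Unary.Decidable P) (f : A → B) xs →
                    length (filter P? (map f xs)) ≡ length (filter (P? ∘ f) xs)
length-filter-map P? f []       = refl
length-filter-map P? f (x ∷ xs) with does (P? (f x))
... | true  = cong suc (length-filter-map P? f xs)
... | false = length-filter-map P? f xs

length-refine-⊎ : ∀ {A : Set} {P Q : A → Set} (P? : Unary.Decidable P) (Q? : Unary.Decidable Q) →
                  (∀ {x} → P x → ¬ Q x) → ∀ xs →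
                  length (refine-list (λ x → P? x ⊎-dec Q? x) xs) ≡ length (filter P? xs) ℕ.+ length (filter Q? xs)
length-refine-⊎ P? Q? disjoint []       = refl
length-refine-⊎ P? Q? disjoint (x ∷ xs) with P? x | Q? x
... | yes p | yes q = contradiction q (disjoint p)
... | yes p | no _  = cong suc (length-refine-⊎ P? Q? disjoint xs)
... | no _  | yes _ = ≡.trans (cong suc (length-refine-⊎ P? Q? disjoint xs)) (≡.sym (ℕ.+-suc _ _))
... | no _  | no _  = length-refine-⊎ P? Q? disjoint xs

count-subsets : ∀ n k → length (filter (λ S → ∣ S ∣ ℕ.≟ k) (subsets n)) ≡ n C k
count-subsets zero    zero    = refl
count-subsets zero    (suc k) = refl
count-subsets (suc n) k       = begin
  length (filter (size? k) (map (outside ∷_) (subsets n) ++ map (inside ∷_) (subsets n)))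
    ≡⟨ cong length (List.filter-++ (size? k) (map (outside ∷_) (subsets n)) _) ⟩
  length (filter (size? k) (map (outside ∷_) (subsets n)) ++ filter (size? k) (map (inside ∷_) (subsets n)))
    ≡⟨ List.length-++ (filter (size? k) (map (outside ∷_) (subsets n))) ⟩
  length (filter (size? k) (map (outside ∷_) (subsets n))) ℕ.+ length (filter (size? k) (map (inside ∷_) (subsets n)))
    ≡⟨ cong₂ ℕ._+_ (length-filter-map (size? k) (outside ∷_) (subsets n)) (length-filter-map (size? k) (inside ∷_) (subsets n)) ⟩
  length (filter (size? k) (subsets n)) ℕ.+ length (filter (λ S → suc ∣ S ∣ ℕ.≟ k) (subsets n))
    ≡⟨ cong (ℕ._+ length (filter (λ S → suc ∣ S ∣ ℕ.≟ k) (subsets n))) (count-subsets n k) ⟩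
  n C k ℕ.+ length (filter (λ S → suc ∣ S ∣ ℕ.≟ k) (subsets n))
    ≡⟨ pascal k ⟩
  suc n C k ∎
  where
  open ≡.≡-Reasoning
  size? : ∀ {n} k → Unary.Decidable (λ (S : Subset n) → ∣ S ∣ ≡ k)
  size? k S = ∣ S ∣ ℕ.≟ k
  pascal : ∀ k → n C k ℕ.+ length (filter (λ S → suc ∣ S ∣ ℕ.≟ k) (subsets n)) ≡ suc n C k
  pascal zero = begin
    n C 0 ℕ.+ length (filter (λ S → suc ∣ S ∣ ℕ.≟ 0) (subsets n))
      ≡⟨ cong (λ xs → n C 0 ℕ.+ length xs) (List.filter-none (λ S → suc ∣ S ∣ ℕ.≟ 0) (All.universal (λ _ ()) (subsets n))) ⟩
    n C 0 ℕ.+ 0        ≡⟨ ℕ.+-identityʳ (n C 0) ⟩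
    n C 0              ≡⟨ ≡.trans (nC0≡1 n) (≡.sym (nC0≡1 (suc n))) ⟩
    suc n C 0          ∎
  pascal (suc k) = begin
    n C suc k ℕ.+ length (filter (λ S → suc ∣ S ∣ ℕ.≟ suc k) (subsets n))
      ≡⟨ cong (λ xs → n C suc k ℕ.+ length xs)
           (List.filter-≐ (λ S → suc ∣ S ∣ ℕ.≟ suc k) (size? k) (ℕ.suc-injective , cong suc) (subsets n)) ⟩
    n C suc k ℕ.+ length (filter (size? k) (subsets n))   ≡⟨ cong (n C suc k ℕ.+_) (count-subsets n k) ⟩
    n C suc k ℕ.+ n C k                                   ≡⟨ ℕ.+-comm (n C suc k) (n C k) ⟩
    n C k ℕ.+ n C suc k                                   ≡⟨ nCk+nC[k+1]≡[n+1]C[k+1] n k ⟩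
    suc n C suc k                                         ∎

order-BL-levels : ∀ n i → Graph.order (BL-levels n (suc i)) ≡ n C i ℕ.+ n C suc i
order-BL-levels n i = ≡.trans
  (length-refine-⊎ (λ S → ∣ S ∣ ℕ.≟ i) (λ S → ∣ S ∣ ℕ.≟ suc i) (λ S≡i S≡1+i → ℕ.1+n≢n (≡.trans (≡.sym S≡1+i) S≡i)) (subsets n))
  (cong₂ ℕ._+_ (count-subsets n i) (count-subsets n (suc i)))

-- The differences telescope, once for each sign. The summation bound `l` is kept apart from `k`,
-- which stays fixed in the eigenvalues during the induction.
sum-multiplicities : ∀ n k l → l ℕ.+ l ℕ.≤ suc n →
                     sum (map proj₂ (concatMap (±-eigenvalues n k) (upTo (suc l)))) ≡ n C l ℕ.+ n C l
sum-multiplicities n k zero    _  = cong (n C 0 ℕ.+_) (ℕ.+-identityʳ (n C 0))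
sum-multiplicities n k (suc l) le = begin
  sum (map proj₂ (concatMap ± (upTo (suc (suc l)))))                      ≡⟨ cong (λ js → sum (map proj₂ (concatMap ± js))) (List.upTo-∷ʳ (suc l)) ⟨
  sum (map proj₂ (concatMap ± (upTo (suc l) ++ suc l ∷ [])))         ≡⟨ cong (sum ∘ map proj₂) (List.concatMap-++ ± (upTo (suc l)) (suc l ∷ [])) ⟩
  sum (map proj₂ (concatMap ± (upTo (suc l)) ++ ± (suc l)))          ≡⟨ cong sum (List.map-++ proj₂ (concatMap ± (upTo (suc l))) (± (suc l))) ⟩
  sum (map proj₂ (concatMap ± (upTo (suc l))) ++ b∸a ∷ b∸a ∷ [])     ≡⟨ sum-++ (map proj₂ (concatMap ± (upTo (suc l)))) (b∸a ∷ b∸a ∷ []) ⟩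
  sum (map proj₂ (concatMap ± (upTo (suc l)))) ℕ.+ (b∸a ℕ.+ (b∸a ℕ.+ 0))  ≡⟨ cong (ℕ._+ (b∸a ℕ.+ (b∸a ℕ.+ 0))) (sum-multiplicities n k l 2l≤n+1) ⟩
  (a ℕ.+ a) ℕ.+ (b∸a ℕ.+ (b∸a ℕ.+ 0))                                     ≡⟨ rearrange a b∸a ⟩
  (b∸a ℕ.+ a) ℕ.+ (b∸a ℕ.+ a)                                             ≡⟨ cong₂ ℕ._+_ b≡ b≡ ⟩
  n C suc l ℕ.+ n C suc l                                                 ∎
  where
  open ≡.≡-Reasoning
  ± : ℕ → List (ℝ × ℕ)
  ± = ±-eigenvalues n k
  a b∸a : ℕ
  a = n C l
  b∸a = n C suc l ∸ a
  b≡ : b∸a ℕ.+ a ≡ n C suc l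
  b≡ = ℕ.m∸n+n≡m (C-increasing n l le)
  2l≤n+1 : l ℕ.+ l ℕ.≤ suc n
  2l≤n+1 = ℕ.≤-trans (ℕ.+-mono-≤ (ℕ.n≤1+n l) (ℕ.n≤1+n l)) le
  rearrange : ∀ a b → (a ℕ.+ a) ℕ.+ (b ℕ.+ (b ℕ.+ 0)) ≡ (b ℕ.+ a) ℕ.+ (b ℕ.+ a)
  rearrange = solve-∀

-- Distinct eigenvalues

fromℕ-difference-unit : ∀ {a b} → a ≢ b → ∃[ r ] (fromℕ a - fromℕ b) *ʳ r ≃ 1ℝ
fromℕ-difference-unit {a} {b} a≢b with ℕ.<-cmp a b
... | tri≈ _ a≡b _ = contradiction a≡b a≢b
... | tri> _ _ b<a = larger (ℕ.m≤n⇒∃[o]m+o≡n b<a)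
  where
  open ≃-Reasoning
  larger : (∃[ e ] suc b ℕ.+ e ≡ a) → ∃[ r ] (fromℕ a - fromℕ b) *ʳ r ≃ 1ℝ
  larger (e , b+1+e≡a) = r , (begin
    (fromℕ a - fromℕ b) *ʳ r                        ≡⟨ cong (λ a → (fromℕ a - fromℕ b) *ʳ r) (≡.trans (≡.sym b+1+e≡a) (≡.sym (ℕ.+-suc b e))) ⟩
    (fromℕ (b ℕ.+ suc e) - fromℕ b) *ʳ r            ≈⟨ *-congʳ (+-congʳ (fromℕ-+ b (suc e))) ⟩
    ((fromℕ b +ʳ fromℕ (suc e)) - fromℕ b) *ʳ r     ≈⟨ pointwise (λ m → solve 3 (λ b e r → ((b :+ e) :- b) :* r := r :* e) refl
                                                        (seq (fromℕ b) m) (seq (fromℕ (suc e)) m) (seq r m)) ⟩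
    r *ʳ fromℕ (suc e)                              ≈⟨ proj₂ (fromℕ-unit (suc e)) ⟩
    1ℝ                                              ∎)
    where
    r : ℝ
    r = proj₁ (fromℕ-unit (suc e))
... | tri< a<b _ _ = smaller (ℕ.m≤n⇒∃[o]m+o≡n a<b)
  where
  open ≃-Reasoning
  smaller : (∃[ e ] suc a ℕ.+ e ≡ b) → ∃[ r ] (fromℕ a - fromℕ b) *ʳ r ≃ 1ℝ
  smaller (e , a+1+e≡b) = -ʳ r , (begin
    (fromℕ a - fromℕ b) *ʳ (-ʳ r)                       ≡⟨ cong (λ b → (fromℕ a - fromℕ b) *ʳ (-ʳ r)) (≡.trans (≡.sym a+1+e≡b) (≡.sym (ℕ.+-suc a e))) ⟩
    (fromℕ a - fromℕ (a ℕ.+ suc e)) *ʳ (-ʳ r)           ≈⟨ *-congʳ (+-congˡ (-ʳ-cong (fromℕ-+ a (suc e)))) ⟩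
    (fromℕ a - (fromℕ a +ʳ fromℕ (suc e))) *ʳ (-ʳ r)    ≈⟨ pointwise (λ m → solve 3 (λ a e r → (a :- (a :+ e)) :* (:- r) := r :* e) refl
                                                            (seq (fromℕ a) m) (seq (fromℕ (suc e)) m) (seq r m)) ⟩
    r *ʳ fromℕ (suc e)                                  ≈⟨ proj₂ (fromℕ-unit (suc e)) ⟩
    1ℝ                                                  ∎)
    where
    r : ℝ
    r = proj₁ (fromℕ-unit (suc e))

-- The inverse of x - y is (x + y) / (a - b). As only the squares enter, this covers every
-- combination of signs and also the eigenvalue 0.
roots-apart : ∀ {x y a b} → x *ʳ x ≃ fromℕ a → y *ʳ y ≃ fromℕ b → a ≢ b → x # y
roots-apart {x} {y} {a} {b} xx≃a yy≃b a≢b = unit⇒# {w = (x +ʳ y) *ʳ r} (begin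
  (x - y) *ʳ ((x +ʳ y) *ʳ r)       ≈⟨ pointwise (λ m → solve 3 (λ x y r → (x :- y) :* ((x :+ y) :* r) := (x :* x :- y :* y) :* r) refl
                                       (seq x m) (seq y m) (seq r m)) ⟩
  (x *ʳ x - y *ʳ y) *ʳ r           ≈⟨ *-congʳ (+ʳ-cong xx≃a (-ʳ-cong yy≃b)) ⟩
  (fromℕ a - fromℕ b) *ʳ r         ≈⟨ proj₂ (fromℕ-difference-unit a≢b) ⟩
  1ℝ                               ∎)
  where
  open ≃-Reasoning
  r : ℝ
  r = proj₁ (fromℕ-difference-unit a≢b)

-- The difference is 2x, with inverse x / (2a).
root-apart-from-negative : ∀ {x a} → .{{ℕ.NonZero a}} → x *ʳ x ≃ fromℕ a → x # (-ʳ x)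
root-apart-from-negative {x} {a} xx≃a = unit⇒# {w = x *ʳ (h *ʳ r)} (begin
  (x - (-ʳ x)) *ʳ (x *ʳ (h *ʳ r))      ≈⟨ pointwise (λ m → solve 3 (λ x h r → (x :- (:- x)) :* (x :* (h :* r)) := (h :+ h) :* (r :* (x :* x))) refl
                                           (seq x m) (seq h m) (seq r m)) ⟩
  (h +ʳ h) *ʳ (r *ʳ (x *ʳ x))          ≈⟨ *-congʳ (pointwise λ _ → refl) ⟩
  1ℝ *ʳ (r *ʳ (x *ʳ x))                ≈⟨ *-identityˡ _ ⟩
  r *ʳ (x *ʳ x)                        ≈⟨ *-congˡ xx≃a ⟩
  r *ʳ fromℕ a                         ≈⟨ proj₂ (fromℕ-unit a) ⟩
  1ℝ                                   ∎)
  where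
  open ≃-Reasoning
  r h : ℝ
  r = proj₁ (fromℕ-unit a)
  h = fromℚ ½

-√-square : ∀ a → (-ʳ √ a) *ʳ (-ʳ √ a) ≃ fromℕ a
-√-square a = ≃-trans (pointwise λ m → solve 1 (λ x → (:- x) :* (:- x) := x :* x) refl (seq (√ a) m)) (√-square a)

0-square : 0ℝ *ʳ 0ℝ ≃ fromℕ 0
0-square = zeroˡ 0ℝ

-- μ² - a factors as (μ - √a)(μ + √a). Thus apartness from the two listed roots gives what the
-- argument for D U requires of μ².
regular-square-difference : ∀ {μ a} → μ # √ a → μ # (-ʳ √ a) → Regular (μ *ʳ μ - fromℕ a)
regular-square-difference {μ} {a} μ#√a μ#-√a = regular-resp (begin
  (μ - √ a) *ʳ (μ - (-ʳ √ a))      ≈⟨ pointwise (λ m → solve 2 (λ x y → (x :- y) :* (x :- (:- y)) := x :* x :- y :* y) refl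
                                       (seq μ m) (seq (√ a) m)) ⟩
  μ *ʳ μ - √ a *ʳ √ a              ≈⟨ +-congˡ (-ʳ-cong (√-square a)) ⟩
  μ *ʳ μ - fromℕ a                 ∎)
  (regular-* (#⇒regular μ#√a) (#⇒regular μ#-√a))
  where open ≃-Reasoning

-- The eigenvalues of D U on level i of the lattice of rank n = 2 i + d + 1

-- The same expression as the local `a` of `±-eigenvalues`, so the two agree by computation.
squared-eigenvalue : ℕ → ℕ → ℕ → ℕ
squared-eigenvalue n k j = (k ∸ j) ℕ.* (n ∸ k ℕ.+ 1 ∸ j)

module _ {n i d : ℕ} (n≡ : n ≡ i ℕ.+ i ℕ.+ suc d) where

  -- With t = i - j and k = i + 1 the factors are k - j = t + 1 and n - k + 1 - j = t + d + 1. The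
  -- parameter n - 2i of the level is `suc d` here, which explains the shift against (t + 1)(t + d).
  squared-eigenvalue≡ : ∀ t j → t ℕ.+ j ≡ i → squared-eigenvalue n (suc i) j ≡ suc t ℕ.* (t ℕ.+ suc d)
  squared-eigenvalue≡ t j t+j≡i = cong₂ ℕ._*_
    (≡.trans (cong (λ i → suc i ∸ j) (≡.sym t+j≡i)) (ℕ.m+n∸n≡m (suc t) j))
    (begin
      n ∸ suc i ℕ.+ 1 ∸ j                                           ≡⟨ cong₂ (λ n i → n ∸ suc i ℕ.+ 1 ∸ j) n≡ (≡.sym t+j≡i) ⟩
      i ℕ.+ i ℕ.+ suc d ∸ suc (t ℕ.+ j) ℕ.+ 1 ∸ j                   ≡⟨ cong (λ i → i ℕ.+ i ℕ.+ suc d ∸ suc (t ℕ.+ j) ℕ.+ 1 ∸ j) t+j≡i ⟨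
      (t ℕ.+ j) ℕ.+ (t ℕ.+ j) ℕ.+ suc d ∸ suc (t ℕ.+ j) ℕ.+ 1 ∸ j   ≡⟨ cong (λ m → m ∸ suc (t ℕ.+ j) ℕ.+ 1 ∸ j) (regroup t j d) ⟩
      (t ℕ.+ d ℕ.+ j) ℕ.+ suc (t ℕ.+ j) ∸ suc (t ℕ.+ j) ℕ.+ 1 ∸ j   ≡⟨ cong (λ m → m ℕ.+ 1 ∸ j) (ℕ.m+n∸n≡m (t ℕ.+ d ℕ.+ j) (suc (t ℕ.+ j))) ⟩
      (t ℕ.+ d ℕ.+ j) ℕ.+ 1 ∸ j                                     ≡⟨ cong (_∸ j) (regroup′ t j d) ⟩
      (t ℕ.+ suc d) ℕ.+ j ∸ j                                       ≡⟨ ℕ.m+n∸n≡m (t ℕ.+ suc d) j ⟩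
      t ℕ.+ suc d                                                   ∎)
    where
    open ≡.≡-Reasoning
    regroup : ∀ t j d → (t ℕ.+ j) ℕ.+ (t ℕ.+ j) ℕ.+ suc d ≡ (t ℕ.+ d ℕ.+ j) ℕ.+ suc (t ℕ.+ j)
    regroup = solve-∀
    regroup′ : ∀ t j d → (t ℕ.+ d ℕ.+ j) ℕ.+ 1 ≡ (t ℕ.+ suc d) ℕ.+ j
    regroup′ = solve-∀

  squared-eigenvalue-nonZero : ∀ {j} → j ℕ.< suc i → ℕ.NonZero (squared-eigenvalue n (suc i) j)
  squared-eigenvalue-nonZero {j} (s≤s j≤i) =
    subst ℕ.NonZero (≡.sym (squared-eigenvalue≡ (i ∸ j) j (ℕ.m∸n+n≡m j≤i))) (positive (i ∸ j))
    where
    positive : ∀ t → ℕ.NonZero (suc t ℕ.* (t ℕ.+ suc d))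
    positive zero    = _
    positive (suc t) = _

  squared-eigenvalue-decreasing : ∀ {j l} → j ℕ.< l → l ℕ.< suc i → squared-eigenvalue n (suc i) l ℕ.< squared-eigenvalue n (suc i) j
  squared-eigenvalue-decreasing {j} {l} j<l (s≤s l≤i) = ≡.subst₂ ℕ._<_
    (≡.sym (squared-eigenvalue≡ (i ∸ l) l (ℕ.m∸n+n≡m l≤i)))
    (≡.sym (squared-eigenvalue≡ (i ∸ j) j (ℕ.m∸n+n≡m (ℕ.≤-trans (ℕ.<⇒≤ j<l) l≤i))))
    (ℕ.*-mono-< (s≤s i∸l<i∸j) (ℕ.+-monoˡ-< (suc d) i∸l<i∸j))
    where
    i∸l<i∸j : i ∸ l ℕ.< i ∸ j
    i∸l<i∸j = ℕ.∸-monoʳ-< j<l l≤i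

  -- Assembly of the spectrum

  open Spectrum (BL-levels n (suc i)) using (adjacency; Eigenspace; HasDimension; IsEigenvalue)
  open TwoLevels n i

  ±-eigenspace-dimension : ∀ {j μ} → j ℕ.< suc i → μ *ʳ μ ≃ fromℕ (squared-eigenvalue n (suc i) j) →
                           HasDimension (Eigenspace adjacency μ) (binomial-difference n j)
  ±-eigenspace-dimension {j} {μ} j<k@(s≤s j≤i) μμ≃a = nonzero-eigenspace-dimension μμ≃a
    (≃-trans (*-comm (fromℕ a) r) (proj₂ (fromℕ-unit a {{a-nonZero}})))
    (≡.subst₂ (λ l b → Spectrum.HasDimension (BL n) (Eigen l (fromℕ b)) (binomial-difference n j))
      t+j≡i (≡.sym (squared-eigenvalue≡ t j t+j≡i))
      (eigen-dimension t (subst (λ l → n ≡ l ℕ.+ l ℕ.+ suc d) (≡.sym t+j≡i) n≡)))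
    where
    a t : ℕ
    a = squared-eigenvalue n (suc i) j
    t = i ∸ j
    t+j≡i : t ℕ.+ j ≡ i
    t+j≡i = ℕ.m∸n+n≡m j≤i
    a-nonZero : ℕ.NonZero a
    a-nonZero = squared-eigenvalue-nonZero j<k
    r : ℝ
    r = proj₁ (fromℕ-unit a {{a-nonZero}})

  eigenvalues : List (ℝ × ℕ)
  eigenvalues = (0ℝ , n C suc i ∸ n C i) ∷ concatMap (±-eigenvalues n (suc i)) (upTo (suc i))

  distinct-eigenvalues : AllPairs (_#_ on proj₁) eigenvalues
  distinct-eigenvalues =
    All.concat⁺ (All.map⁺ (All.applyUpTo⁺₁ (λ j → j) (suc i) λ {j} j<k →
      roots-apart 0-square (√-square (a j)) (0≢a j<k) ∷ roots-apart 0-square (-√-square (a j)) (0≢a j<k) ∷ []))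
    ∷ AllPairs.concat⁺
      (All.map⁺ (All.applyUpTo⁺₁ (λ j → j) (suc i) λ {j} j<k →
        (root-apart-from-negative {{squared-eigenvalue-nonZero j<k}} (√-square (a j)) ∷ []) ∷ [] ∷ []))
      (AllPairs.map⁺ (AllPairs.applyUpTo⁺₁ (λ j → j) (suc i) λ {j} {l} j<l l<k →
        let aⱼ≢aₗ = λ eq → ℕ.<⇒≢ (squared-eigenvalue-decreasing j<l l<k) (≡.sym eq)
        in (roots-apart (√-square (a j)) (√-square (a l)) aⱼ≢aₗ ∷ roots-apart (√-square (a j)) (-√-square (a l)) aⱼ≢aₗ ∷ [])
         ∷ (roots-apart (-√-square (a j)) (√-square (a l)) aⱼ≢aₗ ∷ roots-apart (-√-square (a j)) (-√-square (a l)) aⱼ≢aₗ ∷ [])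
         ∷ []))
    where
    a : ℕ → ℕ
    a = squared-eigenvalue n (suc i)
    0≢a : ∀ {j} → j ℕ.< suc i → 0 ≢ a j
    0≢a j<k 0≡a = ℕ.≢-nonZero⁻¹ _ {{squared-eigenvalue-nonZero j<k}} (≡.sym 0≡a)

  eigenvalue-multiplicities : All (λ (μ , m) → HasDimension (Eigenspace adjacency μ) m) eigenvalues
  eigenvalue-multiplicities = zero-eigenspace-dimension n≡
    ∷ All.concat⁺ (All.map⁺ (All.applyUpTo⁺₁ (λ j → j) (suc i) λ {j} j<k →
        ±-eigenspace-dimension j<k (√-square (squared-eigenvalue n (suc i) j))
      ∷ ±-eigenspace-dimension j<k (-√-square (squared-eigenvalue n (suc i) j))
      ∷ []))

  apart⇒not-eigenvalue : ∀ {μ} → All (λ (ν , _) → μ # ν) eigenvalues → ¬ IsEigenvalue adjacency μ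
  apart⇒not-eigenvalue {μ} (μ#0 ∷ apart) = regular⇒not-eigenvalue n≡
    -- Apartness from the entry 0 makes μ - 0, hence μ itself, cancellable; this is what later
    -- removes the upper half of an eigenvector.
    (regular-resp (≃-trans (+-congˡ (pointwise λ _ → refl)) (+-identityʳ μ)) (#⇒regular μ#0))
    λ t j t+j≡i → subst (λ a → Regular (μ *ʳ μ - fromℕ a)) (squared-eigenvalue≡ t j t+j≡i)
      (regular-± {j} (All.applyUpTo⁻ (λ j → j) (suc i) apart-± (s≤s (subst (j ℕ.≤_) t+j≡i (ℕ.m≤n+m j t)))))
    where
    Apart-± : ℕ → Set
    Apart-± j = All (λ (ν , _) → μ # ν) (±-eigenvalues n (suc i) j)
    apart-± : All Apart-± (upTo (suc i))
    apart-± = All.map⁻ (All.concat⁻ {xss = map (±-eigenvalues n (suc i)) (upTo (suc i))} apart)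
    regular-± : ∀ {j} → Apart-± j → Regular (μ *ʳ μ - fromℕ (squared-eigenvalue n (suc i) j))
    regular-± (μ#√a ∷ μ#-√a ∷ []) = regular-square-difference μ#√a μ#-√a

  total-multiplicity : sum (map proj₂ eigenvalues) ≡ Graph.order (BL-levels n (suc i))
  total-multiplicity = begin
    (b ∸ a) ℕ.+ sum (map proj₂ (concatMap (±-eigenvalues n (suc i)) (upTo (suc i))))
                                ≡⟨ cong (b ∸ a ℕ.+_) (sum-multiplicities n (suc i) i 2i≤n+1) ⟩
    (b ∸ a) ℕ.+ (a ℕ.+ a)       ≡⟨ ℕ.+-assoc (b ∸ a) a a ⟨
    (b ∸ a ℕ.+ a) ℕ.+ a         ≡⟨ cong (ℕ._+ a) (ℕ.m∸n+n≡m (C-increasing n i (below-middle n≡))) ⟩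
    b ℕ.+ a                     ≡⟨ ℕ.+-comm b a ⟩
    a ℕ.+ b                     ≡⟨ order-BL-levels n i ⟨
    Graph.order (BL-levels n (suc i)) ∎
    where
    open ≡.≡-Reasoning
    a b : ℕ
    a = n C i
    b = n C suc i
    2i≤n+1 : i ℕ.+ i ℕ.≤ suc n
    2i≤n+1 = ℕ.≤-trans (ℕ.+-mono-≤ (ℕ.n≤1+n i) (ℕ.n≤1+n i)) (below-middle n≡)

  BL-levels-spectrum : HasSpectrum (BL-levels n (suc i)) eigenvalues
  BL-levels-spectrum = record
    { distinct       = distinct-eigenvalues
    ; multiplicities = eigenvalue-multiplicities
    ; exhaustive     = λ μ eigenvalue →
        ¬all-apart⇒any-equal proj₁ distinct-eigenvalues μ λ apart → apart⇒not-eigenvalue apart eigenvalue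
    ; total          = total-multiplicity
    }

theorem3p1 : (n k : ℕ) → k ≥ 1 → n ≥ 3 → n ≥ 2 * k ∸ 1 →
    HasSpectrum (BL-levels n k)
    ((0ℝ , n C k ∸ n C (k ∸ 1)) ∷ concatMap (±-eigenvalues n k) (upTo k))
theorem3p1 n zero    ()  _ _
-- `d` is the excess of n over 2k - 1, whose value at k = i + 1 computes to `i + suc (i + 0)`; hence
-- n = 2i + 1 + d.
theorem3p1 n (suc i) _   _ n≥2k-1 = BL-levels-spectrum {d = n ∸ (i ℕ.+ suc (i ℕ.+ 0))}
  (≡.trans (≡.sym (ℕ.m+[n∸m]≡n n≥2k-1)) (regroup i _))
  where
  regroup : ∀ i d → i ℕ.+ suc (i ℕ.+ 0) ℕ.+ d ≡ i ℕ.+ i ℕ.+ suc d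
  regroup = solve-∀
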